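{- Let $V$ be a finite-dimensional real vector space and $X\subseteq V$ a finite or countable set in which every $2$-dimensional linear subset has fundamental vectors, equipped with a suitable ordering. Let $\mathcal{C}=\{B_i\}_{i\in I}$ be a maximal chain in the poset (under containment) of subsets of $X$ biclosed in $X$. Then for any distinct $\alpha,\beta\in X$, there is some $B_i\in\mathcal{C}$ with $|\{\alpha,\beta\}\cap B_i|=1$.
   Context: $\mathrm{Span}_+$ denotes nonnegative linear combinations. For $Y\subseteq X$, $B\subseteq Y$: closed in $Y$ if $\alpha,\beta\in B$, $\gamma\in\mathrm{Span}_+(\alpha,\beta)\cap Y$ imply $\gamma\in B$; coclosed if $Y\setminus B$ closed; biclosed if both; weakly separable if $\mathrm{Span}_+(B)\cap\mathrm{Span}_+(Y\setminus B)=\{0\}$; $Y$ is clean if every biclosed subset of $Y$ is weakly separable in $Y$. A maximal chain is a family of biclosed sets totally ordered by containment and maximal with this property. A linear subset is $X\cap L$ for a subspace $L$. A $2$-dimensional linear subset $Y$ has fundamental vectors $\alpha,\beta\in Y$ if $Y\subseteq\mathrm{Span}_+\{\alpha,\beta\}$ and neither $\alpha$ nor $\beta$ lies in the nonnegative span of the other elements of $Y$. $F\subseteq X$ is full if $F\cap\mathrm{Span}\{\alpha,\beta\}=X\cap\mathrm{Span}\{\alpha,\beta\}$ for all $\alpha,\beta\in F$. An ordering $\gamma_1,\gamma_2,\ldots$ of $X$ with initial segments $X_i=\{\gamma_1,\dots,\gamma_i\}$ is suitable if (1) in every $2$-dimensional linear subset the fundamental vectors precede all its other vectors, and (2) for every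 $i$ and $\alpha,\beta,\gamma\in X_i$ there is a full $F\subseteq X$ containing them with $F\cap X_i$ clean.
   Formalization: Added hypothesis: no element of X is a nonnegative multiple of a different element of X (so 0 is not in X unless X={0}); without it no biclosed set separates such a pair, e.g. γ and 2γ in X={α,β,α+β,2(α+β)}, and the claim fails. -}

module Defs where

open import Algebra.Bundles using (CommutativeRing)
open import Algebra.Module.Bundles using (Module)
open import Algebra.Properties.CommutativeMonoid.Sum using (sum)
open import Data.Fin.Base using (Fin; toℕ)
open import Data.Nat.Base as ℕ using (ℕ)
open import Data.Product.Base using (Σ; ∃; ∃₂; _×_; _,_)
open import Data.Sum.Base using (_⊎_)
open import Data.Vec.Functional using (Vector)
open import Function.Base using (id)
open import Function.Bundles using (_⇔_)
open import Level using (Level; suc; _⊔_)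
open import Relation.Binary.Core using (Rel)
open import Relation.Binary.PropositionalEquality.Core using (_≡_; _≢_)
open import Relation.Binary.Structures using (IsTotalOrder)
open import Relation.Nullary.Negation.Core using (¬_)
open import Relation.Unary using (Pred; _∈_; _∉_; _⊆_; _≐_; _∩_; _∖_; U; Satisfiable)

-- Dedekind-complete ordered fields.  Classically such a field is unique up to
-- isomorphism, so quantifying over this record is quantifying over the models
-- of the real numbers.
record RealField (ℓ : Level) : Set (suc ℓ) where
  field
    commutativeRing : CommutativeRing ℓ ℓ
  open CommutativeRing commutativeRing public
  infix 4 _≤_
  field
    _≤_          : Rel Carrier ℓ
    isTotalOrder : IsTotalOrder _≈_ _≤_
    0≉1          : ¬ 0# ≈ 1#
    inverse      : ∀ x → ¬ x ≈ 0# → ∃ λ y → x * y ≈ 1#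
    +-mono-≤     : ∀ {x y} z → x ≤ y → x + z ≤ y + z
    *-nonneg     : ∀ {x y} → 0# ≤ x → 0# ≤ y → 0# ≤ x * y

  UpperBound : Pred Carrier ℓ → Pred Carrier ℓ
  UpperBound S u = ∀ {x} → x ∈ S → x ≤ u

  field
    complete : ∀ (S : Pred Carrier ℓ) → Satisfiable S → Satisfiable (UpperBound S) →
               ∃ λ s → s ∈ UpperBound S × (∀ {u} → u ∈ UpperBound S → s ≤ u)

-- The order types of the enumerations γ₁, γ₂, … of a finite or countable set.
data Length : Set where
  finite : ℕ → Length
  ω      : Length

Position : Length → Set
Position (finite n) = Fin n
Position ω          = ℕ

rank : ∀ {N} → Position N → ℕ
rank {finite n} = toℕ
rank {ω}        = id

module Geometry {ℓ : Level} (ℝ : RealField ℓ)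
                (V : Module (RealField.commutativeRing ℝ) ℓ ℓ) where

  open RealField ℝ using (Carrier; 0#; _≤_; _≈_)
  open Module V using (Carrierᴹ; _≈ᴹ_; _+ᴹ_; _*ₗ_; 0ᴹ; +ᴹ-commutativeMonoid)

  -- Vectors are compared by _≈ᴹ_, and a predicate on Carrierᴹ need not respect
  -- it.  Below this is automatic for the predicates that occur: for X because
  -- it is the ≈ᴹ-image of an enumeration, for a closed subset B because
  -- α ≈ᴹ γ gives γ ∈ Span₊ ⟦ α , α ⟧, and for a full subset because
  -- γ ∈ Span ⟦ α , α ⟧.
  Subset : Set (suc ℓ)
  Subset = Pred Carrierᴹ ℓ

  ⟦_,_⟧ : Carrierᴹ → Carrierᴹ → Subset
  ⟦ α , β ⟧ v = v ≈ᴹ α ⊎ v ≈ᴹ β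

  combination : ∀ {n} → Vector Carrier n → Vector Carrierᴹ n → Carrierᴹ
  combination c b = sum +ᴹ-commutativeMonoid (λ i → c i *ₗ b i)

  Span : Subset → Subset
  Span S v = Σ ℕ λ n → Σ (Vector Carrier n) λ c → Σ (Vector Carrierᴹ n) λ s →
             (∀ i → s i ∈ S) × v ≈ᴹ combination c s

  Span₊ : Subset → Subset
  Span₊ S v = Σ ℕ λ n → Σ (Vector Carrier n) λ c → Σ (Vector Carrierᴹ n) λ s →
              (∀ i → 0# ≤ c i) × (∀ i → s i ∈ S) × v ≈ᴹ combination c s

  record IsSubspace (L : Subset) : Set ℓ where
    field
      resp : ∀ {u v} → u ≈ᴹ v → u ∈ L → v ∈ L
      zero : 0ᴹ ∈ L
      add  : ∀ {u v} → u ∈ L → v ∈ L → u +ᴹ v ∈ L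
      smul : ∀ r {v} → v ∈ L → r *ₗ v ∈ L

  LinearlyIndependent : ∀ {n} → Vector Carrierᴹ n → Set ℓ
  LinearlyIndependent b = ∀ c → combination c b ≈ᴹ 0ᴹ → ∀ i → c i ≈ 0#

  record IsBasis {a n} (L : Pred Carrierᴹ a) (b : Vector Carrierᴹ n) : Set (a ⊔ ℓ) where
    field
      members     : ∀ i → b i ∈ L
      independent : LinearlyIndependent b
      spanning    : ∀ {v} → v ∈ L → ∃ λ c → v ≈ᴹ combination c b

  HasDimension : ∀ {a} → Pred Carrierᴹ a → ℕ → Set (a ⊔ ℓ)
  HasDimension L n = Σ (Vector Carrierᴹ n) (IsBasis L)

  FiniteDimensional : Set ℓ
  FiniteDimensional = ∃ (HasDimension U)

  -- No element of X lies on the closed ray spanned by a different element: 0 is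
  -- not in X (unless X = {0}) and distinct elements of X are not positive
  -- multiples of each other.  Opposite vectors are allowed.  A closed subset
  -- containing α contains every β ∈ X on the ray of α, so biclosed sets can only
  -- separate the elements of X when X is reduced.
  Reduced : Subset → Set ℓ
  Reduced X = ∀ {α β} → α ∈ X → β ∈ X → β ∈ Span₊ (_≈ᴹ α) → α ≈ᴹ β

  Closed : (Y B : Subset) → Set ℓ
  Closed Y B = ∀ {α β γ} → α ∈ B → β ∈ B → γ ∈ Span₊ ⟦ α , β ⟧ ∩ Y → γ ∈ B

  record Biclosed (Y B : Subset) : Set ℓ where
    field
      subset   : B ⊆ Y
      closed   : Closed Y B
      coclosed : Closed Y (Y ∖ B)

  WeaklySeparable : (Y B : Subset) → Set ℓ
  WeaklySeparable Y B = (Span₊ B ∩ Span₊ (Y ∖ B)) ≐ (_≈ᴹ 0ᴹ)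

  Clean : Subset → Set (suc ℓ)
  Clean Y = ∀ B → Biclosed Y B → WeaklySeparable Y B

  LinearSubset : (X Y : Subset) → Set (suc ℓ)
  LinearSubset X Y = Σ Subset λ L → IsSubspace L × Y ≐ (X ∩ L)

  -- The dimension of a linear subset X ∩ L is that of its span, which can be
  -- smaller than that of L.
  TwoDimensionalLinearSubset : (X Y : Subset) → Set (suc ℓ)
  TwoDimensionalLinearSubset X Y = LinearSubset X Y × HasDimension (Span Y) 2

  record Fundamental (Y : Subset) (α β : Carrierᴹ) : Set ℓ where
    field
      α∈Y       : α ∈ Y
      β∈Y       : β ∈ Y
      generate  : Y ⊆ Span₊ ⟦ α , β ⟧
      α-extreme : α ∉ Span₊ (Y ∖ (_≈ᴹ α))
      β-extreme : β ∉ Span₊ (Y ∖ (_≈ᴹ β))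

  HasFundamentalVectors : Subset → Set (suc ℓ)
  HasFundamentalVectors X =
    ∀ Y → TwoDimensionalLinearSubset X Y → ∃₂ (Fundamental Y)

  Full : (X F : Subset) → Set ℓ
  Full X F = F ⊆ X ×
    (∀ {α β} → α ∈ F → β ∈ F → (F ∩ Span ⟦ α , β ⟧) ≐ (X ∩ Span ⟦ α , β ⟧))

  -- An ordering γ₁, γ₂, … of X without repetition, of length at most ω.  In
  -- particular X is finite or countable.
  record Ordering (X : Subset) : Set ℓ where
    field
      length     : Length
      γ          : Position length → Carrierᴹ
      enumerates : ∀ v → v ∈ X ⇔ (∃ λ i → γ i ≈ᴹ v)
      injective  : ∀ {i j} → γ i ≈ᴹ γ j → i ≡ j

    Index : Set
    Index = Position length

    infix 4 _≺_
    _≺_ : Index → Index → Set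
    i ≺ j = rank {length} i ℕ.< rank {length} j

    initial : Index → Subset
    initial i v = ∃ λ j → rank {length} j ℕ.≤ rank {length} i × γ j ≈ᴹ v

  record Suitable {X : Subset} (O : Ordering X) : Set (suc ℓ) where
    open Ordering O
    field
      fundamentals-first :
        ∀ Y → TwoDimensionalLinearSubset X Y →
        ∀ {i j k} → Fundamental Y (γ i) (γ j) → γ k ∈ Y → k ≢ i → k ≢ j →
        i ≺ k × j ≺ k
      locally-clean :
        ∀ i {α β δ} → α ∈ initial i → β ∈ initial i → δ ∈ initial i →
        Σ Subset λ F → Full X F × α ∈ F × β ∈ F × δ ∈ F × Clean (F ∩ initial i)

  module _ {ι : Level} (X : Subset) where

    -- Families of subsets stand for sets of subsets, with _≐_ as equality.
    record IsChain {I : Set ι} (B : I → Subset) : Set (ι ⊔ ℓ) where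
      field
        biclosed : ∀ i → Biclosed X (B i)
        total    : ∀ i j → B i ⊆ B j ⊎ B j ⊆ B i

    _⊑_ : {I J : Set ι} → (I → Subset) → (J → Subset) → Set (ι ⊔ ℓ)
    B ⊑ C = ∀ i → ∃ λ j → B i ≐ C j

    record IsMaximalChain {I : Set ι} (B : I → Subset) : Set (suc ι ⊔ suc ℓ) where
      field
        isChain : IsChain B
        maximal : ∀ {J : Set ι} (C : J → Subset) → IsChain C → B ⊑ C → C ⊑ B

{-# OPTIONS --safe #-}

-- Suppose no member of the chain separates α and β.  The union A of the members
-- avoiding them and the intersection B of the others are biclosed, and by
-- maximality no biclosed set lies strictly between A and B.
--
-- Such a set exists nevertheless.  Let δ and c be the first two elements of B ∖ A,
-- and let Xₙ be the vectors up to and including c.  Then (A ∩ Xₙ) ∪ {c} or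
-- (A ∩ Xₙ) ∪ {δ} is biclosed in Xₙ: otherwise c lies between δ and some β ∉ B and
-- also between δ and some α ∈ A, which contradicts biclosedness of A or B according
-- to the order of α and β on their common line.  A biclosed subset C of an initial
-- segment is then prolonged one vector c at a time, adjoining c exactly when c ∈ A or
-- c is between two elements of C.  If d lies between a ∈ C and the new vector c, then
-- the fundamental vectors f and g of their plane precede c, in the angular order
-- f, a, d, c, g.  This and the weak separability of C in a clean full set show that
-- the prolongation is biclosed.
module Submission where

open import Defs
open import Algebra.Module.Bundles using (Module)
open import Axiom.ExcludedMiddle using (ExcludedMiddle)
open import Data.Empty using (⊥; ⊥-elim)
open import Data.Nat.Base as ℕ using (ℕ)
open import Data.Nat.Properties as ℕₚ using ()
open import Data.Product using (∃; ∃!; ∃₂; _×_; _,_; proj₁; proj₂)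
open import Data.Sum using (_⊎_; inj₁; inj₂; swap)
open import Function using (_∘_)
open import Level using (Level; Lift; lift)
open import Relation.Binary.PropositionalEquality as ≡ using (_≡_; _≢_)
open import Relation.Nullary using (Dec; yes; no; contradiction)
open import Relation.Nullary.Decidable using (decidable-stable; True; toWitness; fromWitness)
open import Relation.Nullary.Negation.Core using (¬_)
open import Relation.Unary using (Pred; _∈_; _∉_; _⊆_; _∩_; _∖_; ∁)

-- Biconvex sets of points for an abstract, ranked betweenness relation.

module Betweenness where

  open import Data.Nat.Base using (zero; suc; _+_; _<_; _≤_; s≤s; _⊔_; _≤′_; ≤′-refl; ≤′-step)
  open import Data.Nat.Induction using (<-rec)
  open import Data.Nat.Properties
  open ≡ using (refl; sym; trans; cong; subst)

  module Convexity {ℓ} {Index : Set} (height : Index → ℕ) (Between : Index → Index → Index → Set ℓ) where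

    -- All three points are restricted to height below `n`, so this expresses closedness relative to
    -- an initial segment; `P` is unconstrained above it.
    ConvexBelow : ℕ → Pred Index ℓ → Set ℓ
    ConvexBelow n P = ∀ {i k j} → height i < n → height k < n → height j < n →
                      P i → P j → Between i k j → P k

    BiconvexBelow : ℕ → Pred Index ℓ → Set ℓ
    BiconvexBelow n P = ConvexBelow n P × ConvexBelow n (∁ P)

    Biconvex : Pred Index ℓ → Set ℓ
    Biconvex P = ∀ n → BiconvexBelow n P

  -- The intended points are positions in the ordering, with `Between i k j` meaning that the vector
  -- at `k` lies in the cone of those at `i` and `j`. In this language `separable` is weak
  -- separability: the cone of two points of `C` and the cone of two points outside `C` cannot share
  -- the later point `c`.
  record RankedBetweenness (ℓ : Level) : Set (Level.suc ℓ) where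
    field
      Index            : Set
      height           : Index → ℕ
      height-injective : ∀ {i j} → height i ≡ height j → i ≡ j
      Between          : Index → Index → Index → Set ℓ

    open Convexity height Between public

    -- In ends, the points of the line through a and c come in the order
    -- f, a, d, c, g, where f and g are the extreme points of that line.
    field
      between-sym  : ∀ {i k j} → Between i k j → Between j k i
      between-refl : ∀ {i k} → Between i k i → k ≡ i
      same-side    : ∀ {i k j j′} → k ≢ i → Between i k j → Between i k j′ →
                     Between i j j′ ⊎ Between i j′ j
      ends         : ∀ {a d c} → a ≢ d → height a < height c → height d < height c → Between a d c →
                     ∃₂ λ f g → height f < height c × height g < height c ×
                                Between f c g × Between f d c × Between a d g × Between d c g
      separable    : ∀ {C a b a′ b′ c} → BiconvexBelow (height c) C →
                     height a < height c → height b < height c →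
                     height a′ < height c → height b′ < height c →
                     C a → C b → ¬ C a′ → ¬ C b′ → Between a c b → Between a′ c b′ → ⊥

  module _ (lem : ∀ {a} → ExcludedMiddle a) where

    least : ∀ {a p} {A : Set a} (f : A → ℕ) (P : Pred A p) → ∃ P →
            ∃ λ x → P x × (∀ {y} → P y → f x ≤ f y)
    least {a} {p} {A} f P (x , Px) = <-rec Goal go (f x) x refl Px
      where
      Goal : ℕ → Set (a Level.⊔ p)
      Goal n = ∀ x → f x ≡ n → P x → ∃ λ x → P x × (∀ {y} → P y → f x ≤ f y)
      go : ∀ n → (∀ {m} → m < n → Goal m) → Goal n
      go n rec x refl Px with lem {P = ∃ λ y → P y × f y < f x}
      ... | yes (y , Py , y<x) = rec y<x y refl Py
      ... | no  x-least        = x , Px , λ {y} Py → ≮⇒≥ λ y<x → x-least (y , Py , y<x)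

    module Interpolation {ℓ} (S : RankedBetweenness ℓ) where
      open RankedBetweenness S

      em : (P : Set ℓ) → Dec P
      em P = lem

      stable : {P : Set ℓ} → ¬ ¬ P → P
      stable = decidable-stable lem

      height≢ : ∀ {i j} → height i < height j → i ≢ j
      height≢ i<j refl = <-irrefl refl i<j

      biconvex-∁ : ∀ {P} → Biconvex P → Biconvex (∁ P)
      biconvex-∁ P-bi n =
        proj₂ (P-bi n) ,
        λ i< k< j< ¬¬Pi ¬¬Pj ikj ¬Pk →
          ¬Pk (proj₁ (P-bi n) i< k< j< (stable ¬¬Pi) (stable ¬¬Pj) ikj)

      -- Prolonging a biconvex set from an initial segment to all points.

      module Extension (A B : Pred Index ℓ) (A-bi : Biconvex A) (B-bi : Biconvex B)
                       (A⊆B : A ⊆ B) where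

        record Stage (n : ℕ) (C : Pred Index ℓ) : Set ℓ where
          field
            bounded  : ∀ {k} → C k → height k < n
            lower    : ∀ {k} → height k < n → A k → C k
            upper    : C ⊆ B
            biconvex : BiconvexBelow n C

        -- At most one point has height `n`. There may be none, as the ordering can be finite; then
        -- nothing is adjoined.
        Step : ℕ → Pred Index ℓ → Pred Index ℓ
        Step n C k = C k ⊎ height k ≡ n × (A k ⊎ ∃₂ λ a b → C a × C b × Between a k b)

        step : ∀ {n C} → Stage n C → Stage (suc n) (Step n C)
        step {n} {C} stage = record
          { bounded  = λ { (inj₁ Ck) → m<n⇒m<1+n (bounded Ck) ; (inj₂ (refl , _)) → n<1+n _ }
          ; lower    = lower′
          ; upper    = upper′
          ; biconvex = convex , coconvex
          }
          where
          open Stage stage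

          lower′ : ∀ {k} → height k < suc n → A k → Step n C k
          lower′ k≤n Ak with m<1+n⇒m<n∨m≡n k≤n
          ... | inj₁ k<n = inj₁ (lower k<n Ak)
          ... | inj₂ k≡n = inj₂ (k≡n , inj₁ Ak)

          upper′ : Step n C ⊆ B
          upper′ (inj₁ Ck) = upper Ck
          upper′ (inj₂ (_ , inj₁ Ak)) = A⊆B Ak
          upper′ (inj₂ (refl , inj₂ (a , b , Ca , Cb , akb))) =
            proj₁ (B-bi (suc n)) (m<n⇒m<1+n (bounded Ca)) (n<1+n _) (m<n⇒m<1+n (bounded Cb))
              (upper Ca) (upper Cb) akb

          old : ∀ {k} → height k < n → Step n C k → C k
          old k<n (inj₁ Ck) = Ck
          old k<n (inj₂ (k≡n , _)) = contradiction k<n (<-irrefl k≡n)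

          -- Suppose `d` is not in `C`. Then neither is `g`, because `d` lies between `a` and `g`.
          -- Each of the two possible reasons for adjoining `c` is then contradictory.
          convex-new : ∀ {a d c} → height a < n → height d < n → height c ≡ n →
                       C a → Step n C c → Between a d c → C d
          convex-new {a} {d} {c} a<n d<n refl Ca Cc adc with lem {P = a ≡ d}
          ... | yes refl = Ca
          ... | no  a≢d with ends a≢d a<n d<n adc
          ...   | f , g , f<n , g<n , fcg , fdc , adg , dcg with em (C g) | em (C d) | Cc
          ...     | _      | yes Cd | _       = Cd
          ...     | yes Cg | no  _  | _       = proj₁ biconvex a<n d<n g<n Ca Cg adg
          ...     | no  _  | no  _  | inj₁ Cc = contradiction (bounded Cc) (<-irrefl refl)
          -- `c` lies between two points of `C` and also between `d` and `g`, both outside `C`.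
          ...     | no ¬Cg | no ¬Cd | inj₂ (_ , inj₂ (a₁ , b₁ , Ca₁ , Cb₁ , a₁cb₁)) =
            ⊥-elim (separable biconvex (bounded Ca₁) (bounded Cb₁) d<n g<n Ca₁ Cb₁ ¬Cd ¬Cg a₁cb₁ dcg)
          -- Here `c` is in `A`. If `f` is too, then so is `d`, which lies between them. Otherwise
          -- `c` lies between `f` and `g`, both outside `A`.
          ...     | no ¬Cg | no ¬Cd | inj₂ (_ , inj₁ Ac) with em (A f)
          ...       | yes Af = lower d<n
            (proj₁ (A-bi (suc n)) (m<n⇒m<1+n f<n) (m<n⇒m<1+n d<n) (n<1+n _) Af Ac fdc)
          ...       | no ¬Af = contradiction Ac
            (proj₂ (A-bi (suc n)) (m<n⇒m<1+n f<n) (n<1+n _) (m<n⇒m<1+n g<n) ¬Af (¬Cg ∘ lower g<n) fcg)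

          convex : ConvexBelow (suc n) (Step n C)
          convex {i} {k} {j} i≤n k≤n j≤n Ci Cj ikj
            with m<1+n⇒m<n∨m≡n i≤n | m<1+n⇒m<n∨m≡n j≤n | m<1+n⇒m<n∨m≡n k≤n
          ... | inj₂ i≡n | _        | inj₂ k≡n with refl ← height-injective (trans i≡n (sym k≡n)) = Ci
          ... | inj₁ _   | inj₂ j≡n | inj₂ k≡n with refl ← height-injective (trans j≡n (sym k≡n)) = Cj
          ... | inj₁ i<n | inj₁ j<n | inj₂ k≡n = inj₂ (k≡n , inj₂ (i , j , old i<n Ci , old j<n Cj , ikj))
          ... | inj₁ i<n | inj₁ j<n | inj₁ k<n = inj₁ (proj₁ biconvex i<n k<n j<n (old i<n Ci) (old j<n Cj) ikj)
          ... | inj₁ i<n | inj₂ j≡n | inj₁ k<n = inj₁ (convex-new i<n k<n j≡n (old i<n Ci) Cj ikj)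
          ... | inj₂ i≡n | inj₁ j<n | inj₁ k<n = inj₁ (convex-new j<n k<n i≡n (old j<n Cj) Ci (between-sym ikj))
          ... | inj₂ i≡n | inj₂ j≡n | inj₁ k<n
            with refl ← height-injective (trans i≡n (sym j≡n)) with refl ← between-refl ikj = Ci

          -- Suppose `d` is in `C`. If `g` is too, then `c`, being between them, would have been
          -- adjoined. Otherwise `d` lies between `a` and `g`, both outside `C`.
          coconvex-new : ∀ {a d c} → height a < n → height d < n → height c ≡ n →
                         ¬ C a → ¬ Step n C c → Between a d c → ¬ C d
          coconvex-new {a} {d} {c} a<n d<n refl ¬Ca ¬Cc adc Cd with lem {P = a ≡ d}
          ... | yes refl = ¬Ca Cd
          ... | no  a≢d with ends a≢d a<n d<n adc
          ...   | f , g , f<n , g<n , fcg , fdc , adg , dcg with em (C g)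
          ...     | yes Cg = ¬Cc (inj₂ (refl , inj₂ (d , g , Cd , Cg , dcg)))
          ...     | no ¬Cg = proj₂ biconvex a<n d<n g<n ¬Ca ¬Cg adg Cd

          coconvex : ConvexBelow (suc n) (∁ (Step n C))
          coconvex {i} {k} {j} i≤n k≤n j≤n ¬Ci ¬Cj ikj Ck
            with m<1+n⇒m<n∨m≡n i≤n | m<1+n⇒m<n∨m≡n j≤n | m<1+n⇒m<n∨m≡n k≤n
          ... | inj₂ i≡n | _        | inj₂ k≡n with refl ← height-injective (trans i≡n (sym k≡n)) = ¬Ci Ck
          ... | inj₁ _   | inj₂ j≡n | inj₂ k≡n with refl ← height-injective (trans j≡n (sym k≡n)) = ¬Cj Ck
          ... | inj₁ i<n | inj₁ j<n | inj₁ k<n =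
            proj₂ biconvex i<n k<n j<n (¬Ci ∘ inj₁) (¬Cj ∘ inj₁) ikj (old k<n Ck)
          ... | inj₁ i<n | inj₂ j≡n | inj₁ k<n = coconvex-new i<n k<n j≡n (¬Ci ∘ inj₁) ¬Cj ikj (old k<n Ck)
          ... | inj₂ i≡n | inj₁ j<n | inj₁ k<n =
            coconvex-new j<n k<n i≡n (¬Cj ∘ inj₁) ¬Ci (between-sym ikj) (old k<n Ck)
          ... | inj₂ i≡n | inj₂ j≡n | inj₁ k<n
            with refl ← height-injective (trans i≡n (sym j≡n)) with refl ← between-refl ikj = ¬Ci Ck
          ... | inj₁ i<n | inj₁ j<n | inj₂ refl with Ck
          ...   | inj₁ Ck′ = <-irrefl refl (bounded Ck′)
          ...   | inj₂ (_ , inj₁ Ak) =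
            proj₂ (A-bi (suc n)) i≤n k≤n j≤n (¬Ci ∘ lower′ i≤n) (¬Cj ∘ lower′ j≤n) ikj Ak
          ...   | inj₂ (_ , inj₂ (a , b , Ca , Cb , akb)) =
            separable biconvex (bounded Ca) (bounded Cb) i<n j<n Ca Cb (¬Ci ∘ inj₁) (¬Cj ∘ inj₁) akb ikj

        -- The union of the successive prolongations.

        module Limit {n₀ : ℕ} {C₀ : Pred Index ℓ} (stage₀ : Stage n₀ C₀) where

          C : ℕ → Pred Index ℓ
          C zero    = C₀
          C (suc d) = Step (d + n₀) (C d)

          stage : ∀ d → Stage (d + n₀) (C d)
          stage zero    = stage₀
          stage (suc d) = step (stage d)

          C-mono : ∀ {d e} → d ≤ e → C d ⊆ C e
          C-mono d≤e = go (≤⇒≤′ d≤e)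
            where
            go : ∀ {d e} → d ≤′ e → C d ⊆ C e
            go ≤′-refl       Ck = Ck
            go (≤′-step d≤e) Ck = inj₁ (go d≤e Ck)

          limit : Pred Index ℓ
          limit k = ∃ λ d → C d k

          -- Every adjoined point has height `d + n₀` for some `d`, hence at least `n₀`.
          limit∩initial⊆ : ∀ {k} → height k < n₀ → limit k → C₀ k
          limit∩initial⊆ k<n₀ (zero  , Ck) = Ck
          limit∩initial⊆ k<n₀ (suc d , inj₁ Ck) = limit∩initial⊆ k<n₀ (d , Ck)
          limit∩initial⊆ k<n₀ (suc d , inj₂ (k≡ , _)) =
            contradiction k<n₀ (≤⇒≯ (≤-trans (m≤n+m n₀ d) (≤-reflexive (sym k≡))))

          A⊆limit : A ⊆ limit
          A⊆limit {k} Ak = suc (height k) , Stage.lower (stage (suc (height k))) (s≤s (m≤m+n _ _)) Ak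

          limit⊆B : limit ⊆ B
          limit⊆B (d , Ck) = Stage.upper (stage d) Ck

          -- Each instance involves three points and so takes place in a single late stage. The
          -- maximum with `n` brings their heights below the bound of that stage.
          limit-biconvex : Biconvex limit
          limit-biconvex n = convex , coconvex
            where
            below : ∀ {k} d → height k < n → height k < (d ⊔ n) + n₀
            below d k<n = m≤n⇒m≤n+o n₀ (≤-trans k<n (m≤n⊔m d n))
            convex : ConvexBelow n limit
            convex i< k< j< (d , Ci) (e , Cj) ikj =
              (d ⊔ e) ⊔ n ,
              proj₁ (Stage.biconvex (stage ((d ⊔ e) ⊔ n))) (below _ i<) (below _ k<) (below _ j<)
                (C-mono (≤-trans (m≤m⊔n d e) (m≤m⊔n _ n)) Ci)
                (C-mono (≤-trans (m≤n⊔m d e) (m≤m⊔n _ n)) Cj) ikj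
            coconvex : ConvexBelow n (∁ limit)
            coconvex i< k< j< ¬Ci ¬Cj ikj (d , Ck) =
              proj₂ (Stage.biconvex (stage (d ⊔ n))) (below _ i<) (below _ k<) (below _ j<)
                (λ Ci → ¬Ci (d ⊔ n , Ci)) (λ Cj → ¬Cj (d ⊔ n , Cj)) ikj (C-mono (m≤m⊔n d n) Ck)

      -- Adjoining one point to a biconvex set.

      Adjoin : Pred Index ℓ → Index → Pred Index ℓ
      Adjoin A c k = height k < height c × A k ⊎ height k ≡ height c

      module _ (A B : Pred Index ℓ) (A-bi : Biconvex A) (B-bi : Biconvex B) (A⊆B : A ⊆ B)
               {δ c : Index} (δ<c : height δ < height c) (c∈B∖A : c ∈ B ∖ A)
               (only-δ : ∀ {k} → height k < height c → k ∈ B ∖ A → k ≡ δ) where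

        -- Any failure involves `δ`, the only point of `B ∖ A` below `c`. If convexity fails at `d`,
        -- then `d` is `δ`, and the extreme point `g` beyond `c` is a forbidden `β`. If coconvexity
        -- fails at `c`, then one of its two neighbours is `δ` and the other is a forbidden `β`,
        -- since `B` is coconvex.
        adjoin-biconvex : ¬ (∃ λ β → height β < height c × ¬ B β × Between δ c β) →
                          BiconvexBelow (suc (height c)) (Adjoin A c)
        adjoin-biconvex no-β = convex , coconvex
          where
          ≤c : ∀ {k} → height k < height c → height k < suc (height c)
          ≤c = m<n⇒m<1+n

          convex-new : ∀ {a d} → height a < height c → height d < height c → A a → Between a d c → A d
          convex-new {a} {d} a<c d<c Aa adc with em (A d) | lem {P = a ≡ d}
          ... | yes Ad | _        = Ad
          ... | no ¬Ad | yes refl = Aa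
          ... | no ¬Ad | no a≢d
            with refl ← only-δ d<c
                   (proj₁ (B-bi _) (≤c a<c) (≤c d<c) (n<1+n _) (A⊆B Aa) (proj₁ c∈B∖A) adc , ¬Ad)
            with ends a≢d a<c d<c adc
          ...   | f , g , f<c , g<c , fcg , fdc , adg , dcg with em (A g) | em (B g)
          ...     | yes Ag | _      = proj₁ (A-bi _) a<c d<c g<c Aa Ag adg
          ...     | no ¬Ag | no ¬Bg = ⊥-elim (no-β (g , g<c , ¬Bg , dcg))
          ...     | no ¬Ag | yes Bg with refl ← only-δ g<c (Bg , ¬Ag) =
            contradiction (sym (between-refl dcg)) (height≢ d<c)

          convex : ConvexBelow (suc (height c)) (Adjoin A c)
          convex {i} {k} {j} i≤ k≤ j≤ Ci Cj ikj with m<1+n⇒m<n∨m≡n k≤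
          ... | inj₂ k≡c = inj₂ k≡c
          ... | inj₁ k<c with Ci | Cj
          ...   | inj₁ (_ , Ai)   | inj₁ (_ , Aj) = inj₁ (k<c , proj₁ (A-bi _) i≤ k≤ j≤ Ai Aj ikj)
          ...   | inj₁ (i<c , Ai) | inj₂ j≡c with refl ← height-injective j≡c =
            inj₁ (k<c , convex-new i<c k<c Ai ikj)
          convex _ _ _ _ _ ikj | inj₁ k<c | inj₂ i≡c | inj₁ (j<c , Aj) with refl ← height-injective i≡c =
            inj₁ (k<c , convex-new j<c k<c Aj (between-sym ikj))
          convex _ _ _ _ _ ikj | inj₁ k<c | inj₂ i≡c | inj₂ j≡c
            with refl ← height-injective i≡c with refl ← height-injective j≡c =
            contradiction (between-refl ikj) (height≢ k<c)

          below : ∀ {k} → height k < suc (height c) → ¬ Adjoin A c k → height k < height c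
          below k≤ ¬Ck = ≤∧≢⇒< (m<1+n⇒m≤n k≤) (¬Ck ∘ inj₂)

          coconvex : ConvexBelow (suc (height c)) (∁ (Adjoin A c))
          coconvex {i} {k} {j} i≤ k≤ j≤ ¬Ci ¬Cj ikj Ck = go Ck
            where
            i<c = below i≤ ¬Ci
            j<c = below j≤ ¬Cj
            ¬Ai : ¬ A i
            ¬Ai Ai = ¬Ci (inj₁ (i<c , Ai))
            ¬Aj : ¬ A j
            ¬Aj Aj = ¬Cj (inj₁ (j<c , Aj))

            go : ¬ Adjoin A c k
            go (inj₁ (_ , Ak)) = proj₂ (A-bi _) i≤ k≤ j≤ ¬Ai ¬Aj ikj Ak
            go (inj₂ k≡c) with refl ← height-injective k≡c with em (B i) | em (B j)
            ... | no ¬Bi | no ¬Bj = proj₂ (B-bi _) i≤ k≤ j≤ ¬Bi ¬Bj ikj (proj₁ c∈B∖A)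
            ... | yes Bi | no ¬Bj with refl ← only-δ i<c (Bi , ¬Ai) = no-β (j , j<c , ¬Bj , ikj)
            ... | no ¬Bi | yes Bj with refl ← only-δ j<c (Bj , ¬Aj) =
              no-β (i , i<c , ¬Bi , between-sym ikj)
            ... | yes Bi | yes Bj with refl ← only-δ i<c (Bi , ¬Ai) with refl ← only-δ j<c (Bj , ¬Aj) =
              contradiction (sym (between-refl ikj)) (height≢ i<c)

      -- Existence of a biconvex set strictly between two others.

      record Interpolant (A B : Pred Index ℓ) : Set (Level.suc ℓ) where
        field
          C          : Pred Index ℓ
          C-biconvex : Biconvex C
          A⊆C        : A ⊆ C
          C⊆B        : C ⊆ B
          k k′       : Index
          k∈C∖A      : k ∈ C ∖ A
          k′∈B∖C     : k′ ∈ B ∖ C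

      module _ (A B : Pred Index ℓ) (A-bi : Biconvex A) (B-bi : Biconvex B) (A⊆B : A ⊆ B) where
        open Extension A B A-bi B-bi A⊆B

        -- Both inclusions stay strict in the limit: prolongation keeps `k` and adjoins nothing
        -- below `n`, so `k′` remains outside.
        interpolant-from : ∀ {n C k k′} → Stage n C → height k < n → height k′ < n →
                           k ∈ C ∖ A → k′ ∈ B ∖ C → Interpolant A B
        interpolant-from {k = k} {k′} stage k<n k′<n (Ck , ¬Ak) (Bk′ , ¬Ck′) = record
          { C          = limit
          ; C-biconvex = limit-biconvex
          ; A⊆C        = A⊆limit
          ; C⊆B        = limit⊆B
          ; k          = k
          ; k′         = k′
          ; k∈C∖A      = (0 , Ck) , ¬Ak
          ; k′∈B∖C     = Bk′ , ¬Ck′ ∘ limit∩initial⊆ k′<n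
          }
          where open Limit stage

        interpolate-at : ∀ {δ c} → height δ < height c → δ ∈ B ∖ A → c ∈ B ∖ A →
                         (∀ {k} → height k < height c → k ∈ B ∖ A → k ≡ δ) → Interpolant A B
        interpolate-at {δ} {c} δ<c (Bδ , ¬Aδ) (Bc , ¬Ac) only-δ
          with em (∃ λ β → height β < height c × ¬ B β × Between δ c β)
        ... | no no-β = interpolant-from
          record { bounded = λ { (inj₁ (k<c , _)) → m<n⇒m<1+n k<c ; (inj₂ k≡c) → ≤-reflexive (cong suc k≡c) }
                 ; lower = lower
                 ; upper = λ { (inj₁ (_ , Ak)) → A⊆B Ak ; (inj₂ k≡c) → subst B (sym (height-injective k≡c)) Bc }
                 ; biconvex = adjoin-biconvex A B A-bi B-bi A⊆B δ<c (Bc , ¬Ac) only-δ no-β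
                 }
          (n<1+n _) (m<n⇒m<1+n δ<c) (inj₂ refl , ¬Ac)
          (Bδ , λ { (inj₁ (_ , Aδ)) → ¬Aδ Aδ ; (inj₂ δ≡c) → <-irrefl δ≡c δ<c })
          where
          lower : ∀ {k} → height k < suc (height c) → A k → Adjoin A c k
          lower k≤ Ak with m<1+n⇒m<n∨m≡n k≤
          ... | inj₁ k<c = inj₁ (k<c , Ak)
          ... | inj₂ k≡c = inj₂ k≡c
        -- Dually, adjoin-biconvex is applied to the complements ∁ B ⊆ ∁ A.
        ... | yes (β , β<c , ¬Bβ , δcβ) = interpolant-from
          record { bounded = m<n⇒m<1+n ∘ proj₁
                 ; lower = λ {k} k≤ Ak → ≤∧≢⇒< (m<1+n⇒m≤n k≤)
                             (λ k≡c → ¬Ac (subst A (height-injective k≡c) Ak)) , A⊆B Ak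
                 ; upper = proj₂
                 ; biconvex = convex , coconvex
                 }
          (m<n⇒m<1+n δ<c) (n<1+n _) ((δ<c , Bδ) , ¬Aδ) (Bc , λ c∈C → <-irrefl refl (proj₁ c∈C))
          where
          -- Seen from `δ` through `c`, the points `α` and `β` lie on the same side. Either `α` is
          -- between `δ` and `β`, both outside `A`, or `β` is between `δ` and `α`, both in `B`.
          no-α : ¬ (∃ λ α → height α < height c × ¬ ¬ A α × Between δ c α)
          no-α (α , α<c , ¬¬Aα , δcα) with same-side (height≢ δ<c ∘ sym) δcα δcβ
          ... | inj₁ δαβ = ¬¬Aα
            (proj₂ (A-bi _) δ<c α<c β<c ¬Aδ (¬Bβ ∘ A⊆B) δαβ)
          ... | inj₂ δβα = ¬Bβ
            (proj₁ (B-bi _) δ<c β<c α<c Bδ (A⊆B (stable ¬¬Aα)) δβα)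

          bi : BiconvexBelow (suc (height c)) (Adjoin (∁ B) c)
          bi = adjoin-biconvex (∁ B) (∁ A) (biconvex-∁ B-bi) (biconvex-∁ A-bi) (λ ¬Bk → ¬Bk ∘ A⊆B)
                 δ<c (¬Ac , (λ ¬Bc → ¬Bc Bc))
                 (λ k<c (¬Ak , ¬¬Bk) → only-δ k<c (stable ¬¬Bk , ¬Ak)) no-α

          -- Up to the height of `c`, this is the complement of `Adjoin (∁ B) c`. It is also `A`
          -- below `c` with `δ` adjoined, because `B ∖ A` contains no other point there.
          C : Pred Index ℓ
          C k = height k < height c × B k

          to : ∀ {k} → C k → ¬ Adjoin (∁ B) c k
          to (_ , Bk)  (inj₁ (_ , ¬Bk)) = ¬Bk Bk
          to (k<c , _) (inj₂ k≡c)       = <-irrefl k≡c k<c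

          from : ∀ {k} → height k < suc (height c) → ¬ Adjoin (∁ B) c k → C k
          from k≤ k∉ = k<c , stable (λ ¬Bk → k∉ (inj₁ (k<c , ¬Bk)))
            where k<c = ≤∧≢⇒< (m<1+n⇒m≤n k≤) (k∉ ∘ inj₂)

          convex : ConvexBelow (suc (height c)) C
          convex i≤ k≤ j≤ Ci Cj ikj = from k≤ (proj₂ bi i≤ k≤ j≤ (to Ci) (to Cj) ikj)

          coconvex : ConvexBelow (suc (height c)) (∁ C)
          coconvex i≤ k≤ j≤ ¬Ci ¬Cj ikj Ck = to Ck
            (proj₁ bi i≤ k≤ j≤ (stable (¬Ci ∘ from i≤)) (stable (¬Cj ∘ from j≤)) ikj)

        interpolate : ∀ {k k′} → k ≢ k′ → k ∈ B ∖ A → k′ ∈ B ∖ A → Interpolant A B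
        interpolate {k} {k′} k≢k′ k∈ k′∈ with least height (B ∖ A) (k , k∈)
        ... | δ , δ∈ , δ-least with least height (λ i → i ∈ B ∖ A × i ≢ δ) other
          where
          -- Of the two distinct points `k` and `k′`, at least one differs from `δ`.
          other : ∃ λ i → i ∈ B ∖ A × i ≢ δ
          other with lem {P = k ≡ δ}
          ... | yes refl = k′ , k′∈ , k≢k′ ∘ sym
          ... | no  k≢δ  = k , k∈ , k≢δ
        ...   | c , (c∈ , c≢δ) , c-least =
          interpolate-at (≤∧≢⇒< (δ-least c∈) (c≢δ ∘ sym ∘ height-injective)) δ∈ c∈
            (λ i<c i∈ → decidable-stable lem λ i≢δ → <⇒≱ i<c (c-least (i∈ , i≢δ)))

open Betweenness
open import Algebra.Bundles using (module CommutativeMonoid)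
open import Data.Fin.Base using (zero; suc; fromℕ<)
open import Data.Fin.Properties using (toℕ-injective; toℕ-fromℕ<; toℕ<n)
open import Data.Maybe.Base using (Maybe; just; nothing; maybe′)
open import Data.Vec.Functional using (Vector; _∷_; [])
open import Function.Bundles using (module Equivalence)
open import Relation.Binary.Structures using (IsTotalOrder)
import Relation.Binary.Reasoning.Setoid as SetoidReasoning

-- Arithmetic of ordered fields.

module OrderedField {ℓ} (ℝ : RealField ℓ) where
  open RealField ℝ hiding (zero)
  open IsTotalOrder isTotalOrder public
    using (total; ≤-respʳ-≈; ≤-respˡ-≈; antisym) renaming (refl to ≤-refl; trans to ≤-trans)
  open import Algebra.Properties.Ring ring using (-‿distribˡ-*; -‿distribʳ-*; -‿involutive)

  +-nonneg : ∀ {x y} → 0# ≤ x → 0# ≤ y → 0# ≤ x + y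
  +-nonneg {x} {y} 0≤x 0≤y = ≤-trans 0≤y (≤-respˡ-≈ (+-identityˡ y) (+-mono-≤ y 0≤x))

  ≤⇒0≤- : ∀ {x y} → x ≤ y → 0# ≤ y + - x
  ≤⇒0≤- {x} {y} x≤y = ≤-respˡ-≈ (-‿inverseʳ x) (+-mono-≤ (- x) x≤y)

  ≤0⇒0≤- : ∀ {x} → x ≤ 0# → 0# ≤ - x
  ≤0⇒0≤- {x} x≤0 = ≤-respʳ-≈ (+-identityˡ (- x)) (≤⇒0≤- x≤0)

  0≤1 : 0# ≤ 1#
  0≤1 with total 0# 1#
  ... | inj₁ 0≤1 = 0≤1
  ... | inj₂ 1≤0 = ≤-respʳ-≈ -1*-1≈1 (*-nonneg (≤0⇒0≤- 1≤0) (≤0⇒0≤- 1≤0))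
    where
    -1*-1≈1 : - 1# * - 1# ≈ 1#
    -1*-1≈1 = trans (sym (-‿distribˡ-* 1# (- 1#)))
                    (trans (-‿cong (*-identityˡ (- 1#))) (-‿involutive 1#))

  inverse-nonneg : ∀ {x y} → 0# ≤ x → x * y ≈ 1# → 0# ≤ y
  inverse-nonneg {x} {y} 0≤x xy≈1 with total 0# y
  ... | inj₁ 0≤y = 0≤y
  ... | inj₂ y≤0 = contradiction (antisym 0≤1 1≤0) 0≉1
    where
    0≤-1 : 0# ≤ - 1#
    0≤-1 = ≤-respʳ-≈ (trans (sym (-‿distribʳ-* x y)) (-‿cong xy≈1)) (*-nonneg 0≤x (≤0⇒0≤- y≤0))
    1≤0 : 1# ≤ 0#
    1≤0 = ≤-respˡ-≈ (+-identityˡ 1#) (≤-respʳ-≈ (-‿inverseˡ 1#) (+-mono-≤ 1# 0≤-1))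

  +-nonneg-≉0 : ∀ {x y} → 0# ≤ x → 0# ≤ y → ¬ x ≈ 0# → ¬ x + y ≈ 0#
  +-nonneg-≉0 {x} {y} 0≤x 0≤y x≉0 x+y≈0 = x≉0 (antisym x≤0 0≤x)
    where
    x≤0 : x ≤ 0#
    x≤0 = ≤-respʳ-≈ (trans (+-comm y x) x+y≈0) (≤-respˡ-≈ (+-identityˡ x) (+-mono-≤ x 0≤y))

-- Planes and cones spanned by two vectors.

module LinearCombinations {ℓ} (ℝ : RealField ℓ) (V : Module (RealField.commutativeRing ℝ) ℓ ℓ) where
  open RealField ℝ hiding (zero)
  open OrderedField ℝ
  open Module V
  open Geometry ℝ V
  open import Algebra.Properties.CommutativeMonoid.Sum +ᴹ-commutativeMonoid using (sum)
  open import Algebra.Properties.CommutativeSemigroup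
    (CommutativeMonoid.commutativeSemigroup +ᴹ-commutativeMonoid) using (interchange)
  open import Algebra.Properties.AbelianGroup +ᴹ-abelianGroup using (∙-cancelˡ)
  open SetoidReasoning ≈ᴹ-setoid

  lin : Carrier → Carrier → Carrierᴹ → Carrierᴹ → Carrierᴹ
  lin x y u v = x *ₗ u +ᴹ y *ₗ v

  lin-cong : ∀ {x x′ y y′ u u′ v v′} → x ≈ x′ → y ≈ y′ → u ≈ᴹ u′ → v ≈ᴹ v′ →
             lin x y u v ≈ᴹ lin x′ y′ u′ v′
  lin-cong x≈ y≈ u≈ v≈ = +ᴹ-cong (*ₗ-cong x≈ u≈) (*ₗ-cong y≈ v≈)

  lin-swap : ∀ {w} x y u v → w ≈ᴹ lin x y u v → w ≈ᴹ lin y x v u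
  lin-swap x y u v w≈ = ≈ᴹ-trans w≈ (+ᴹ-comm _ _)

  lin-zeroˡ : ∀ {x} y u v → x ≈ 0# → lin x y u v ≈ᴹ y *ₗ v
  lin-zeroˡ {x} y u v x≈0 = begin
    x *ₗ u +ᴹ y *ₗ v  ≈⟨ +ᴹ-congʳ (≈ᴹ-trans (*ₗ-congʳ x≈0) (*ₗ-zeroˡ u)) ⟩
    0ᴹ +ᴹ y *ₗ v      ≈⟨ +ᴹ-identityˡ _ ⟩
    y *ₗ v            ∎

  lin-zeroʳ : ∀ x {y} u v → y ≈ 0# → lin x y u v ≈ᴹ x *ₗ u
  lin-zeroʳ x {y} u v y≈0 = ≈ᴹ-trans (+ᴹ-comm _ _) (lin-zeroˡ x v u y≈0)

  lin-1-0 : ∀ u v → u ≈ᴹ lin 1# 0# u v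
  lin-1-0 u v = ≈ᴹ-sym (≈ᴹ-trans (lin-zeroʳ 1# u v refl) (*ₗ-identityˡ u))

  lin-0-1 : ∀ u v → v ≈ᴹ lin 0# 1# u v
  lin-0-1 u v = ≈ᴹ-sym (≈ᴹ-trans (lin-zeroˡ 1# u v refl) (*ₗ-identityˡ v))

  lin-zero : ∀ u v → lin 0# 0# u v ≈ᴹ 0ᴹ
  lin-zero u v = ≈ᴹ-trans (lin-zeroˡ 0# u v refl) (*ₗ-zeroˡ v)

  *ₗ-lin : ∀ s x y u v → s *ₗ lin x y u v ≈ᴹ lin (s * x) (s * y) u v
  *ₗ-lin s x y u v =
    ≈ᴹ-trans (*ₗ-distribˡ s _ _) (≈ᴹ-sym (+ᴹ-cong (*ₗ-assoc s x u) (*ₗ-assoc s y v)))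

  lin+lin : ∀ x y x′ y′ u v → lin x y u v +ᴹ lin x′ y′ u v ≈ᴹ lin (x + x′) (y + y′) u v
  lin+lin x y x′ y′ u v =
    ≈ᴹ-trans (interchange _ _ _ _) (≈ᴹ-sym (+ᴹ-cong (*ₗ-distribʳ u x x′) (*ₗ-distribʳ v y y′)))

  lin-lin : ∀ p q {w x y w′ x′ y′ u v} → w ≈ᴹ lin x y u v → w′ ≈ᴹ lin x′ y′ u v →
            lin p q w w′ ≈ᴹ lin (p * x + q * x′) (p * y + q * y′) u v
  lin-lin p q {w} {x} {y} {w′} {x′} {y′} {u} {v} w≈ w′≈ = begin
    p *ₗ w +ᴹ q *ₗ w′                                     ≈⟨ lin-cong refl refl w≈ w′≈ ⟩
    p *ₗ lin x y u v +ᴹ q *ₗ lin x′ y′ u v                ≈⟨ +ᴹ-cong (*ₗ-lin p x y u v) (*ₗ-lin q x′ y′ u v) ⟩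
    lin (p * x) (p * y) u v +ᴹ lin (q * x′) (q * y′) u v  ≈⟨ lin+lin _ _ _ _ u v ⟩
    lin (p * x + q * x′) (p * y + q * y′) u v             ∎

  unscale : ∀ {s t w w′} → s * t ≈ 1# → s *ₗ w ≈ᴹ w′ → w ≈ᴹ t *ₗ w′
  unscale {s} {t} {w} {w′} st≈1 sw≈ = begin
    w               ≈⟨ *ₗ-identityˡ w ⟨
    1# *ₗ w         ≈⟨ *ₗ-congʳ (trans (sym st≈1) (*-comm s t)) ⟩
    (t * s) *ₗ w    ≈⟨ *ₗ-assoc t s w ⟩
    t *ₗ (s *ₗ w)   ≈⟨ *ₗ-congˡ sw≈ ⟩
    t *ₗ w′         ∎

  -- The span and the nonnegative span of two vectors, with exactly one coefficient for each, so
  -- that membership can be computed with.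
  Plane Cone : Carrierᴹ → Carrierᴹ → Subset
  Plane u v w = ∃₂ λ x y → w ≈ᴹ lin x y u v
  Cone  u v w = ∃₂ λ x y → 0# ≤ x × 0# ≤ y × w ≈ᴹ lin x y u v

  cone⊆plane : ∀ {u v} → Cone u v ⊆ Plane u v
  cone⊆plane (x , y , _ , _ , w≈) = x , y , w≈

  cone-sym : ∀ {u v w} → Cone u v w → Cone v u w
  cone-sym (x , y , 0≤x , 0≤y , w≈) = y , x , 0≤y , 0≤x , lin-swap x y _ _ w≈

  cone-cong : ∀ {u u′ v v′ w w′} → u ≈ᴹ u′ → v ≈ᴹ v′ → w ≈ᴹ w′ → Cone u v w → Cone u′ v′ w′
  cone-cong u≈ v≈ w≈ (x , y , 0≤x , 0≤y , w≈lin) =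
    x , y , 0≤x , 0≤y , ≈ᴹ-trans (≈ᴹ-sym w≈) (≈ᴹ-trans w≈lin (lin-cong refl refl u≈ v≈))

  cone-trans : ∀ {u v w w′ z} → Cone u v w → Cone u v w′ → Cone w w′ z → Cone u v z
  cone-trans (x , y , 0≤x , 0≤y , w≈) (x′ , y′ , 0≤x′ , 0≤y′ , w′≈) (p , q , 0≤p , 0≤q , z≈) =
    _ , _ , +-nonneg (*-nonneg 0≤p 0≤x) (*-nonneg 0≤q 0≤x′) ,
            +-nonneg (*-nonneg 0≤p 0≤y) (*-nonneg 0≤q 0≤y′) , ≈ᴹ-trans z≈ (lin-lin p q w≈ w′≈)

  cone-left : ∀ {u v} → Cone u v u
  cone-left {u} {v} = 1# , 0# , 0≤1 , ≤-refl , lin-1-0 u v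

  cone-right : ∀ {u v} → Cone u v v
  cone-right = cone-sym cone-left

  cone-unscale : ∀ {s x y u v w} → 0# ≤ s → ¬ s ≈ 0# → 0# ≤ x → 0# ≤ y →
                 s *ₗ w ≈ᴹ lin x y u v → Cone u v w
  cone-unscale {s} {x} {y} 0≤s s≉0 0≤x 0≤y sw≈ with inverse s s≉0
  ... | t , st≈1 = t * x , t * y , *-nonneg 0≤t 0≤x , *-nonneg 0≤t 0≤y ,
                   ≈ᴹ-trans (unscale st≈1 sw≈) (*ₗ-lin t x y _ _)
    where 0≤t = inverse-nonneg 0≤s st≈1

  -- The hypothesis a₂ c₁ ≤ a₁ c₂ says that a is at least as close to p as c is.
  cone-nearer : ∀ {a₁ a₂ c₁ c₂ p q a c} → 0# ≤ a₂ → 0# ≤ c₂ → ¬ c₂ ≈ 0# → a₂ * c₁ ≤ a₁ * c₂ →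
                a ≈ᴹ lin a₁ a₂ p q → c ≈ᴹ lin c₁ c₂ p q → Cone p c a
  cone-nearer {a₁} {a₂} {c₁} {c₂} {p} {q} {a} {c} 0≤a₂ 0≤c₂ c₂≉0 le a≈ c≈ =
    cone-unscale 0≤c₂ c₂≉0 (≤⇒0≤- le) 0≤a₂ (begin
      c₂ *ₗ a                                  ≈⟨ *ₗ-congˡ a≈ ⟩
      c₂ *ₗ lin a₁ a₂ p q                      ≈⟨ *ₗ-lin c₂ a₁ a₂ p q ⟩
      lin (c₂ * a₁) (c₂ * a₂) p q              ≈⟨ lin-cong coeff₁ coeff₂ ≈ᴹ-refl ≈ᴹ-refl ⟩
      lin (D * 1# + a₂ * c₁) (D * 0# + a₂ * c₂) p q ≈⟨ lin-lin D a₂ (lin-1-0 p q) c≈ ⟨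
      lin D a₂ p c                             ∎)
    where
    -- The determinant of `a` and `c` in the coordinates given by `p` and `q`; eliminating `q` gives
    -- `c₂ a = D p + a₂ c`.
    D = a₁ * c₂ + - (a₂ * c₁)
    coeff₁ : c₂ * a₁ ≈ D * 1# + a₂ * c₁
    coeff₁ = sym (trans (+-congʳ (*-identityʳ D)) (trans (+-assoc _ _ _)
      (trans (+-congˡ (-‿inverseˡ _)) (trans (+-identityʳ _) (*-comm a₁ c₂)))))
    coeff₂ : c₂ * a₂ ≈ D * 0# + a₂ * c₂
    coeff₂ = sym (trans (+-congʳ (zeroʳ D)) (trans (+-identityˡ _) (*-comm a₂ c₂)))

  -- Eliminating `a` between `d = x a + y c` and `c = u a + w q` gives `(x + u y) c = u d + x w q`,
  -- whose left coefficient is nonzero because `x` is.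
  cone-chain : ∀ {x y a d c q} → 0# ≤ x → 0# ≤ y → ¬ x ≈ 0# → d ≈ᴹ lin x y a c → Cone a q c → Cone d q c
  cone-chain {x} {y} {a} {d} {c} {q} 0≤x 0≤y x≉0 d≈ (u , w , 0≤u , 0≤w , c≈) =
    cone-unscale (+-nonneg 0≤x (*-nonneg 0≤u 0≤y)) (+-nonneg-≉0 0≤x (*-nonneg 0≤u 0≤y) x≉0)
      0≤u (*-nonneg 0≤x 0≤w) (begin
        (x + u * y) *ₗ c                                      ≈⟨ *ₗ-distribʳ c x (u * y) ⟩
        x *ₗ c +ᴹ (u * y) *ₗ c                                ≈⟨ +ᴹ-congʳ (≈ᴹ-trans (*ₗ-congˡ c≈) (*ₗ-lin x u w a q)) ⟩
        ((x * u) *ₗ a +ᴹ (x * w) *ₗ q) +ᴹ (u * y) *ₗ c        ≈⟨ +ᴹ-assoc _ _ _ ⟩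
        (x * u) *ₗ a +ᴹ ((x * w) *ₗ q +ᴹ (u * y) *ₗ c)        ≈⟨ +ᴹ-cong (*ₗ-congʳ (*-comm x u)) (+ᴹ-comm _ _) ⟩
        (u * x) *ₗ a +ᴹ ((u * y) *ₗ c +ᴹ (x * w) *ₗ q)        ≈⟨ +ᴹ-assoc _ _ _ ⟨
        lin (u * x) (u * y) a c +ᴹ (x * w) *ₗ q               ≈⟨ +ᴹ-congʳ (≈ᴹ-trans (*ₗ-congˡ d≈) (*ₗ-lin u x y a c)) ⟨
        u *ₗ d +ᴹ (x * w) *ₗ q                                ∎)

  -- Cancelling `a p` leaves `b β = (c - a) p + d α`, with nonnegative coefficients on the right.
  cone-same-side : ∀ {a b c d p β α} → 0# ≤ b → ¬ b ≈ 0# → 0# ≤ d → a ≤ c →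
                   lin a b p β ≈ᴹ lin c d p α → Cone p α β
  cone-same-side {a} {b} {c} {d} {p} {β} {α} 0≤b b≉0 0≤d a≤c eq =
    cone-unscale 0≤b b≉0 (≤⇒0≤- a≤c) 0≤d (∙-cancelˡ (a *ₗ p) _ _ (begin
      a *ₗ p +ᴹ b *ₗ β                              ≈⟨ eq ⟩
      c *ₗ p +ᴹ d *ₗ α                              ≈⟨ +ᴹ-congʳ (*ₗ-congʳ split) ⟩
      (a + (c + - a)) *ₗ p +ᴹ d *ₗ α                ≈⟨ +ᴹ-congʳ (*ₗ-distribʳ p a (c + - a)) ⟩
      (a *ₗ p +ᴹ (c + - a) *ₗ p) +ᴹ d *ₗ α          ≈⟨ +ᴹ-assoc _ _ _ ⟩
      a *ₗ p +ᴹ lin (c + - a) d p α                 ∎))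
    where
    split : c ≈ a + (c + - a)
    split = sym (trans (+-comm a _) (trans (+-assoc c _ a)
      (trans (+-congˡ (-‿inverseˡ a)) (+-identityʳ c))))

  plane-isSubspace : ∀ u v → IsSubspace (Plane u v)
  plane-isSubspace u v = record
    { resp = λ w≈ (x , y , w≈lin) → x , y , ≈ᴹ-trans (≈ᴹ-sym w≈) w≈lin
    ; zero = 0# , 0# , ≈ᴹ-sym (lin-zero u v)
    ; add  = λ (x , y , w≈) (x′ , y′ , w′≈) →
               x + x′ , y + y′ , ≈ᴹ-trans (+ᴹ-cong w≈ w′≈) (lin+lin x y x′ y′ u v)
    ; smul = λ r (x , y , w≈) → r * x , r * y , ≈ᴹ-trans (*ₗ-congˡ w≈) (*ₗ-lin r x y u v)
    }

  sum-closed : (P : Subset) → 0ᴹ ∈ P → (∀ {u v} → u ∈ P → v ∈ P → u +ᴹ v ∈ P) →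
               ∀ {n} (t : Vector Carrierᴹ n) → (∀ i → t i ∈ P) → sum t ∈ P
  sum-closed P 0∈P add {ℕ.zero}  t t∈P = 0∈P
  sum-closed P 0∈P add {ℕ.suc n} t t∈P = add (t∈P zero) (sum-closed P 0∈P add (t ∘ suc) (t∈P ∘ suc))

  span⊆ : ∀ {S L} → IsSubspace L → S ⊆ L → Span S ⊆ L
  span⊆ {L = L} sub S⊆L (n , c , s , s∈S , v≈) =
    resp (≈ᴹ-sym v≈) (sum-closed L zero′ add _ (λ i → smul (c i) (S⊆L (s∈S i))))
    where open IsSubspace sub renaming (zero to zero′)

  -- A combination may use `u` and `v` many times; its terms can be collected because the cone is
  -- closed under addition.
  span₊⇒cone : ∀ {u v w} → w ∈ Span₊ ⟦ u , v ⟧ → Cone u v w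
  span₊⇒cone {u} {v} (n , c , s , 0≤c , s∈ , w≈) =
    cone-cong ≈ᴹ-refl ≈ᴹ-refl (≈ᴹ-sym w≈) (sum-closed (Cone u v)
      (0# , 0# , ≤-refl , ≤-refl , ≈ᴹ-sym (lin-zero u v))
      (λ (x , y , 0≤x , 0≤y , w≈) (x′ , y′ , 0≤x′ , 0≤y′ , w′≈) →
         x + x′ , y + y′ , +-nonneg 0≤x 0≤x′ , +-nonneg 0≤y 0≤y′ ,
         ≈ᴹ-trans (+ᴹ-cong w≈ w′≈) (lin+lin x y x′ y′ u v))
      _ (λ i → ray (0≤c i) (s∈ i)))
    where
    ray : ∀ {c s} → 0# ≤ c → s ∈ ⟦ u , v ⟧ → Cone u v (c *ₗ s)
    ray {c} 0≤c (inj₁ s≈u) = c , 0# , 0≤c , ≤-refl , ≈ᴹ-trans (*ₗ-congˡ s≈u) (≈ᴹ-sym (lin-zeroʳ c u v refl))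
    ray {c} 0≤c (inj₂ s≈v) = 0# , c , ≤-refl , 0≤c , ≈ᴹ-trans (*ₗ-congˡ s≈v) (≈ᴹ-sym (lin-zeroˡ c u v refl))

  combination-pair : ∀ (c : Vector Carrier 2) b → combination c b ≈ᴹ
                     lin (c zero) (c (suc zero)) (b zero) (b (suc zero))
  combination-pair c b = +ᴹ-congˡ (+ᴹ-identityʳ _)

  plane⊆span : ∀ {S u v} → u ∈ S → v ∈ S → Plane u v ⊆ Span S
  plane⊆span {u = u} {v} u∈S v∈S (x , y , w≈) =
    2 , c , b , (λ { zero → u∈S ; (suc zero) → v∈S }) , ≈ᴹ-trans w≈ (≈ᴹ-sym (combination-pair c b))
    where
    c = x ∷ y ∷ []
    b = u ∷ v ∷ []

  cone⊆span₊ : ∀ {S u v} → u ∈ S → v ∈ S → Cone u v ⊆ Span₊ S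
  cone⊆span₊ {u = u} {v} u∈S v∈S (x , y , 0≤x , 0≤y , w≈) =
    2 , c , b , (λ { zero → 0≤x ; (suc zero) → 0≤y }) , (λ { zero → u∈S ; (suc zero) → v∈S }) ,
    ≈ᴹ-trans w≈ (≈ᴹ-sym (combination-pair c b))
    where
    c = x ∷ y ∷ []
    b = u ∷ v ∷ []

  cone⇒span₊ : ∀ {u v} → Cone u v ⊆ Span₊ ⟦ u , v ⟧
  cone⇒span₊ {u} {v} = cone⊆span₊ {S = ⟦ u , v ⟧} (inj₁ ≈ᴹ-refl) (inj₂ ≈ᴹ-refl)

  ray⊆span₊ : ∀ {u w x} → 0# ≤ x → w ≈ᴹ x *ₗ u → w ∈ Span₊ (_≈ᴹ u)
  ray⊆span₊ {u} {w} {x} 0≤x w≈ = 1 , (λ _ → x) , (λ _ → u) , (λ _ → 0≤x) , (λ _ → ≈ᴹ-refl) ,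
    ≈ᴹ-trans w≈ (≈ᴹ-sym (+ᴹ-identityʳ _))

  span₊-mono : ∀ {S T} → S ⊆ T → Span₊ S ⊆ Span₊ T
  span₊-mono S⊆T (n , c , s , 0≤c , s∈S , v≈) = n , c , s , 0≤c , S⊆T ∘ s∈S , v≈

  span₊-resp : ∀ {S v w} → v ≈ᴹ w → v ∈ Span₊ S → w ∈ Span₊ S
  span₊-resp v≈w (n , c , s , 0≤c , s∈S , v≈) = n , c , s , 0≤c , s∈S , ≈ᴹ-trans (≈ᴹ-sym v≈w) v≈

  -- With `t` inverse to `y`, one has `v = t w - t x u`.
  plane-solve : ∀ {x y u v w} → ¬ y ≈ 0# → w ≈ᴹ lin x y u v → Plane u w v
  plane-solve {x} {y} {u} {v} {w} y≉0 w≈ with inverse y y≉0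
  ... | t , yt≈1 = - (t * x) , t , ≈ᴹ-sym (begin
    lin (- (t * x)) t u w                                          ≈⟨ lin-lin (- (t * x)) t (lin-1-0 u v) w≈ ⟩
    lin (- (t * x) * 1# + t * x) (- (t * x) * 0# + t * y) u v      ≈⟨ lin-cong c₁ c₂ ≈ᴹ-refl ≈ᴹ-refl ⟩
    lin 0# 1# u v                                                  ≈⟨ lin-0-1 u v ⟨
    v                                                              ∎)
    where
    c₁ : - (t * x) * 1# + t * x ≈ 0#
    c₁ = trans (+-congʳ (*-identityʳ _)) (-‿inverseˡ _)
    c₂ : - (t * x) * 0# + t * y ≈ 1#
    c₂ = trans (+-congʳ (zeroʳ _)) (trans (+-identityˡ _) (trans (*-comm t y) yt≈1))

rank-injective : ∀ N {i j : Position N} → rank {N} i ≡ rank {N} j → i ≡ j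
rank-injective (finite n) = toℕ-injective
rank-injective ω          = λ eq → eq

-- This lets the vectors strictly before `c` be written as a segment `initial i`.
predecessor : ∀ N (c : Position N) {n} → rank {N} c ≡ ℕ.suc n → ∃ λ (i : Position N) → rank {N} i ≡ n
predecessor (finite N) c {n} eq = fromℕ< n<N , toℕ-fromℕ< n<N
  where n<N = ℕₚ.<-trans (ℕₚ.≤-reflexive (≡.sym eq)) (toℕ<n c)
predecessor ω c {n} eq = n , ≡.refl

-- The betweenness relation of a suitably ordered set of vectors.

module OrderedConfiguration
  (lem : ∀ {a} → ExcludedMiddle a)
  {ℓ} (ℝ : RealField ℓ) (V : Module (RealField.commutativeRing ℝ) ℓ ℓ) (X : Geometry.Subset ℝ V)
  (reduced : Geometry.Reduced ℝ V X) (fundamental : Geometry.HasFundamentalVectors ℝ V X)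
  (O : Geometry.Ordering ℝ V X) (suitable : Geometry.Suitable ℝ V O) where

  open Geometry ℝ V
  open RealField ℝ hiding (zero)
  open OrderedField ℝ
  open Module V
  open LinearCombinations ℝ V
  open import Algebra.Properties.Ring ring using (-‿distribˡ-*; -‿involutive; -0#≈0#)
  open Ordering O
  open Suitable suitable
  open SetoidReasoning ≈ᴹ-setoid

  rk : Index → ℕ
  rk = rank {length}

  stable : ∀ {a} {P : Set a} → ¬ ¬ P → P
  stable = decidable-stable lem

  γ∈X : ∀ i → γ i ∈ X
  γ∈X i = Equivalence.from (enumerates (γ i)) (i , ≈ᴹ-refl)

  index : ∀ {v} → v ∈ X → ∃ λ i → γ i ≈ᴹ v
  index {v} = Equivalence.to (enumerates v)

  X-resp : ∀ {u v} → u ≈ᴹ v → u ∈ X → v ∈ X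
  X-resp {u} {v} u≈v u∈X with index u∈X
  ... | i , γi≈u = Equivalence.from (enumerates v) (i , ≈ᴹ-trans γi≈u u≈v)

  Between : Index → Index → Index → Set ℓ
  Between i k j = Cone (γ i) (γ j) (γ k)

  -- This is reducedness in terms of positions. It includes `x = 0`: a zero vector at `k` would
  -- force `k ≡ i` for every `i`.
  on-ray : ∀ {i k x} → 0# ≤ x → γ k ≈ᴹ x *ₗ γ i → k ≡ i
  on-ray 0≤x γk≈ = ≡.sym (injective (reduced (γ∈X _) (γ∈X _) (ray⊆span₊ 0≤x γk≈)))

  coeffˡ≉0 : ∀ {i k j x y} → k ≢ j → 0# ≤ y → γ k ≈ᴹ lin x y (γ i) (γ j) → ¬ x ≈ 0#
  coeffˡ≉0 {i} {k} {j} {x} {y} k≢j 0≤y γk≈ x≈0 =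
    k≢j (on-ray 0≤y (≈ᴹ-trans γk≈ (lin-zeroˡ y (γ i) (γ j) x≈0)))

  coeffʳ≉0 : ∀ {i k j x y} → k ≢ i → 0# ≤ x → γ k ≈ᴹ lin x y (γ i) (γ j) → ¬ y ≈ 0#
  coeffʳ≉0 k≢i 0≤x γk≈ = coeffˡ≉0 k≢i 0≤x (lin-swap _ _ _ _ γk≈)

  between-refl : ∀ {i k} → Between i k i → k ≡ i
  between-refl {i} (x , y , 0≤x , 0≤y , γk≈) =
    on-ray (+-nonneg 0≤x 0≤y) (≈ᴹ-trans γk≈ (≈ᴹ-sym (*ₗ-distribʳ (γ i) x y)))

  -- Of the two expressions for `γ k`, the one with the smaller coefficient at `γ i` has its other
  -- endpoint nearer to `i`.
  same-side : ∀ {i k j j′} → k ≢ i → Between i k j → Between i k j′ →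
              Between i j j′ ⊎ Between i j′ j
  same-side k≢i (a , b , 0≤a , 0≤b , γk≈) (c , d , 0≤c , 0≤d , γk≈′) with total a c
  ... | inj₁ a≤c = inj₁ (cone-same-side 0≤b (coeffʳ≉0 k≢i 0≤a γk≈) 0≤d a≤c
                          (≈ᴹ-trans (≈ᴹ-sym γk≈) γk≈′))
  ... | inj₂ c≤a = inj₂ (cone-same-side 0≤d (coeffʳ≉0 k≢i 0≤c γk≈′) 0≤b c≤a
                          (≈ᴹ-trans (≈ᴹ-sym γk≈′) γk≈))

  collinear-sum : ∀ {r x y u v w} → u ≈ᴹ r *ₗ v → w ≈ᴹ lin x y u v → w ≈ᴹ (x * r + y) *ₗ v
  collinear-sum {r} {x} {y} {u} {v} {w} u≈ w≈ = begin
    w                         ≈⟨ w≈ ⟩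
    x *ₗ u +ᴹ y *ₗ v          ≈⟨ +ᴹ-congʳ (*ₗ-congˡ u≈) ⟩
    x *ₗ (r *ₗ v) +ᴹ y *ₗ v   ≈⟨ +ᴹ-congʳ (*ₗ-assoc x r v) ⟨
    (x * r) *ₗ v +ᴹ y *ₗ v    ≈⟨ *ₗ-distribʳ v (x * r) y ⟨
    (x * r + y) *ₗ v          ∎

  -- Of three vectors on a line through 0, two lie on the same side of 0.
  not-collinear : ∀ {a d c r} → a ≢ d → a ≢ c → d ≢ c → Between a d c → ¬ (γ a ≈ᴹ r *ₗ γ c)
  not-collinear {a} {d} {c} {r} a≢d a≢c d≢c (x , y , 0≤x , 0≤y , γd≈) γa≈
    with total 0# r | total 0# (x * r + y)
  ... | inj₁ 0≤r | _        = a≢c (on-ray 0≤r γa≈)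
  ... | inj₂ r≤0 | inj₁ 0≤t = d≢c (on-ray 0≤t (collinear-sum γa≈ γd≈))
  ... | inj₂ r≤0 | inj₂ t≤0 =
    a≢d (≡.sym (between-refl (cone-unscale (≤0⇒0≤- r≤0) -r≉0 (≤0⇒0≤- t≤0) ≤-refl (begin
      (- r) *ₗ γ d              ≈⟨ *ₗ-congˡ (collinear-sum γa≈ γd≈) ⟩
      (- r) *ₗ (t *ₗ γ c)       ≈⟨ *ₗ-assoc (- r) t (γ c) ⟨
      (- r * t) *ₗ γ c          ≈⟨ *ₗ-congʳ -r*t≈-t*r ⟩
      (- t * r) *ₗ γ c          ≈⟨ *ₗ-assoc (- t) r (γ c) ⟩
      (- t) *ₗ (r *ₗ γ c)       ≈⟨ *ₗ-congˡ γa≈ ⟨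
      (- t) *ₗ γ a              ≈⟨ lin-zeroʳ (- t) (γ a) (γ a) refl ⟨
      lin (- t) 0# (γ a) (γ a)  ∎))))
    where
    t : Carrier
    t = x * r + y
    -r≉0 : ¬ - r ≈ 0#
    -r≉0 -r≈0 = a≢c (on-ray ≤-refl (≈ᴹ-trans γa≈ (*ₗ-congʳ
      (trans (sym (-‿involutive r)) (trans (-‿cong -r≈0) -0#≈0#)))))
    -r*t≈-t*r : - r * t ≈ - t * r
    -r*t≈-t*r = trans (sym (-‿distribˡ-* r t)) (trans (-‿cong (*-comm r t)) (-‿distribˡ-* t r))

  -- Otherwise the relation could be solved for `γ a` as a multiple of `γ c`. The third point `d`
  -- excludes that `γ a` and `γ c` are opposite, which reducedness alone would permit.
  coefficient≈0 : ∀ {a d c p q} → a ≢ d → a ≢ c → d ≢ c → Between a d c →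
                  lin p q (γ a) (γ c) ≈ᴹ 0ᴹ → p ≈ 0#
  coefficient≈0 {a} {d} {c} {p} {q} a≢d a≢c d≢c adc eq = stable λ p≉0 →
    let x , y , γa≈ = plane-solve {x = q} {u = γ c} {v = γ a} p≉0 (≈ᴹ-trans (≈ᴹ-sym eq) (+ᴹ-comm _ _))
    in not-collinear a≢d a≢c d≢c adc (begin
         γ a                   ≈⟨ γa≈ ⟩
         x *ₗ γ c +ᴹ y *ₗ 0ᴹ   ≈⟨ +ᴹ-congˡ (*ₗ-zeroʳ y) ⟩
         x *ₗ γ c +ᴹ 0ᴹ        ≈⟨ +ᴹ-identityʳ _ ⟩
         x *ₗ γ c              ∎)

  fundamental-resp : ∀ {Y f f′ g g′} → (∀ {u v} → u ≈ᴹ v → u ∈ Y → v ∈ Y) →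
                     f ≈ᴹ f′ → g ≈ᴹ g′ → Fundamental Y f g → Fundamental Y f′ g′
  fundamental-resp {Y} {f} {f′} {g} {g′} Y-resp f≈ g≈ fund = record
    { α∈Y       = Y-resp f≈ α∈Y
    ; β∈Y       = Y-resp g≈ β∈Y
    ; generate  = λ v∈Y → cone⇒span₊ (cone-cong f≈ g≈ ≈ᴹ-refl (span₊⇒cone (generate v∈Y)))
    ; α-extreme = extreme f≈ α-extreme
    ; β-extreme = extreme g≈ β-extreme
    }
    where
    open Fundamental fund
    extreme : ∀ {h h′} → h ≈ᴹ h′ → h ∉ Span₊ (Y ∖ (_≈ᴹ h)) → h′ ∉ Span₊ (Y ∖ (_≈ᴹ h′))
    extreme {h} {h′} h≈ h∉ h′∈ = h∉
      (span₊-mono {S = Y ∖ (_≈ᴹ h′)} {T = Y ∖ (_≈ᴹ h)}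
        (λ (v∈Y , v≉) → v∈Y , λ v≈h → v≉ (≈ᴹ-trans v≈h h≈))
        (span₊-resp {S = Y ∖ (_≈ᴹ h′)} (≈ᴹ-sym h≈) h′∈))

  Ends : Index → Index → Index → Set ℓ
  Ends a d c = ∃₂ λ f g → f ≺ c × g ≺ c ×
               Between f c g × Between f d c × Between a d g × Between d c g

  -- The generators p and q are ordered along the line by the sign of a determinant.
  ends-oriented : ∀ {a d c p q a₁ a₂ c₁ c₂} → d ≢ c → a ≢ c → c ≢ p → c ≢ q → p ≺ c → q ≺ c →
    0# ≤ a₁ → 0# ≤ a₂ → 0# ≤ c₁ → 0# ≤ c₂ →
    γ a ≈ᴹ lin a₁ a₂ (γ p) (γ q) → γ c ≈ᴹ lin c₁ c₂ (γ p) (γ q) → a₂ * c₁ ≤ a₁ * c₂ →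
    Between a d c → Ends a d c
  ends-oriented {a} {d} {c} {p} {q} {a₁} {a₂} {c₁} {c₂} d≢c a≢c c≢p c≢q p≺c q≺c
                0≤a₁ 0≤a₂ 0≤c₁ 0≤c₂ a≈ c≈ le adc@(x , y , 0≤x , 0≤y , d≈) =
    p , q , p≺c , q≺c , (c₁ , c₂ , 0≤c₁ , 0≤c₂ , c≈) ,
    cone-trans pac cone-right adc ,
    cone-trans cone-left acq adc ,
    cone-chain 0≤x 0≤y (coeffˡ≉0 d≢c 0≤y d≈) d≈ acq
    where
    c₁≉0 : ¬ c₁ ≈ 0#
    c₁≉0 = coeffˡ≉0 c≢q 0≤c₂ c≈
    c₂≉0 : ¬ c₂ ≈ 0#
    c₂≉0 = coeffʳ≉0 c≢p 0≤c₁ c≈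
    pac : Between p a c
    pac = cone-nearer 0≤a₂ 0≤c₂ c₂≉0 le a≈ c≈
    -- Otherwise the determinant inequality forces `c₁ a₂ = 0`, so `γ a` vanishes and `a` equals
    -- `c`.
    a₁≉0 : ¬ a₁ ≈ 0#
    a₁≉0 a₁≈0 = a≢c (between-refl (cone-unscale 0≤c₁ c₁≉0 ≤-refl ≤-refl (begin
      c₁ *ₗ γ a                             ≈⟨ *ₗ-congˡ a≈ ⟩
      c₁ *ₗ lin a₁ a₂ (γ p) (γ q)           ≈⟨ *ₗ-lin c₁ a₁ a₂ (γ p) (γ q) ⟩
      lin (c₁ * a₁) (c₁ * a₂) (γ p) (γ q)   ≈⟨ lin-cong (trans (*-congˡ a₁≈0) (zeroʳ c₁)) c₁a₂≈0 ≈ᴹ-refl ≈ᴹ-refl ⟩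
      lin 0# 0# (γ p) (γ q)                 ≈⟨ lin-zero (γ p) (γ q) ⟩
      0ᴹ                                    ≈⟨ lin-zero (γ c) (γ c) ⟨
      lin 0# 0# (γ c) (γ c)                 ∎)))
      where
      c₁a₂≈0 : c₁ * a₂ ≈ 0#
      c₁a₂≈0 = antisym
        (≤-respʳ-≈ (trans (*-congʳ a₁≈0) (zeroˡ c₂)) (≤-respˡ-≈ (*-comm a₂ c₁) le))
        (*-nonneg 0≤c₁ 0≤a₂)
    acq : Between a c q
    acq = cone-sym (cone-nearer 0≤c₁ 0≤a₁ a₁≉0
            (≤-respˡ-≈ (*-comm a₂ c₁) (≤-respʳ-≈ (*-comm a₁ c₂) le))
            (lin-swap _ _ _ _ c≈) (lin-swap _ _ _ _ a≈))

  module _ {a d c} (a≢d : a ≢ d) (a≺c : a ≺ c) (d≺c : d ≺ c) (adc : Between a d c) where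

    a≢c : a ≢ c
    a≢c ≡.refl = ℕₚ.<-irrefl ≡.refl a≺c

    d≢c : d ≢ c
    d≢c ≡.refl = ℕₚ.<-irrefl ≡.refl d≺c

    Line : Subset
    Line = X ∩ Plane (γ a) (γ c)

    line-resp : ∀ {u v} → u ≈ᴹ v → u ∈ Line → v ∈ Line
    line-resp u≈v (u∈X , u∈P) = X-resp u≈v u∈X , IsSubspace.resp (plane-isSubspace _ _) u≈v u∈P

    a∈ : γ a ∈ Line
    a∈ = γ∈X a , 1# , 0# , lin-1-0 _ _

    c∈ : γ c ∈ Line
    c∈ = γ∈X c , 0# , 1# , lin-0-1 _ _

    d∈ : γ d ∈ Line
    d∈ = γ∈X d , cone⊆plane adc

    line-2-dimensional : TwoDimensionalLinearSubset X Line
    line-2-dimensional =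
      (Plane (γ a) (γ c) , plane-isSubspace (γ a) (γ c) , (λ v∈ → v∈) , (λ v∈ → v∈)) ,
      b , record
        { members     = λ { zero → generator a∈ ; (suc zero) → generator c∈ }
        ; independent = λ e eq → independent e (≈ᴹ-trans (≈ᴹ-sym (combination-pair e b)) eq)
        ; spanning    = λ v∈ →
            let x , y , v≈ = span⊆ {S = Line} (plane-isSubspace (γ a) (γ c)) proj₂ v∈
            in x ∷ y ∷ [] , ≈ᴹ-trans v≈ (≈ᴹ-sym (combination-pair (x ∷ y ∷ []) b))
        }
      where
      b : Vector Carrierᴹ 2
      b = γ a ∷ γ c ∷ []
      generator : Line ⊆ Span Line
      generator v∈ = plane⊆span {S = Line} v∈ v∈ (1# , 0# , lin-1-0 _ _)
      independent : ∀ (e : Vector Carrier 2) → lin (e zero) (e (suc zero)) (γ a) (γ c) ≈ᴹ 0ᴹ →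
                    ∀ i → e i ≈ 0#
      independent e eq zero       = coefficient≈0 a≢d a≢c d≢c adc eq
      independent e eq (suc zero) =
        coefficient≈0 (d≢c ∘ ≡.sym) (a≢c ∘ ≡.sym) (a≢d ∘ ≡.sym) (cone-sym adc)
          (≈ᴹ-trans (+ᴹ-comm _ _) eq)

    -- If c were fundamental, then a and d would both be the other fundamental vector.
    not-fundamental : ∀ {p q} → (∀ {k} → γ k ∈ Line → k ≢ p → k ≢ q → p ≺ k) → c ≢ p
    not-fundamental {p} {q} first ≡.refl = a≢d (≡.trans (≡q a∈ a≺c) (≡.sym (≡q d∈ d≺c)))
      where
      ≡q : ∀ {k} → γ k ∈ Line → k ≺ c → k ≡ q
      ≡q {k} k∈ k≺c = stable λ k≢q →
        ℕₚ.<-asym k≺c (first k∈ (λ { ≡.refl → ℕₚ.<-irrefl ≡.refl k≺c }) k≢q)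

    -- The fundamental vectors of the line differ from `c` and therefore precede it. The one on the
    -- side of `a` serves as `f`, the one on the side of `c` as `g`.
    ends : Ends a d c
    ends with fundamental Line line-2-dimensional
    ... | f , g , fund₀ with index (proj₁ (Fundamental.α∈Y fund₀)) | index (proj₁ (Fundamental.β∈Y fund₀))
    ...   | p , γp≈ | q , γq≈ = orient (span₊⇒cone (generate a∈)) (span₊⇒cone (generate c∈))
      where
      fund : Fundamental Line (γ p) (γ q)
      fund = fundamental-resp line-resp (≈ᴹ-sym γp≈) (≈ᴹ-sym γq≈) fund₀
      open Fundamental fund
      first : ∀ {k} → γ k ∈ Line → k ≢ p → k ≢ q → p ≺ k × q ≺ k
      first = fundamentals-first Line line-2-dimensional fund
      c≢p : c ≢ p
      c≢p = not-fundamental (λ k∈ k≢p k≢q → proj₁ (first k∈ k≢p k≢q))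
      c≢q : c ≢ q
      c≢q = not-fundamental (λ k∈ k≢q k≢p → proj₂ (first k∈ k≢p k≢q))
      p≺c : p ≺ c
      p≺c = proj₁ (first c∈ c≢p c≢q)
      q≺c : q ≺ c
      q≺c = proj₂ (first c∈ c≢p c≢q)
      orient : Between p a q → Between p c q → Ends a d c
      orient (a₁ , a₂ , 0≤a₁ , 0≤a₂ , a≈) (c₁ , c₂ , 0≤c₁ , 0≤c₂ , c≈) with total (a₂ * c₁) (a₁ * c₂)
      ... | inj₁ le = ends-oriented d≢c a≢c c≢p c≢q p≺c q≺c 0≤a₁ 0≤a₂ 0≤c₁ 0≤c₂ a≈ c≈ le adc
      ... | inj₂ ge = ends-oriented d≢c a≢c c≢q c≢p q≺c p≺c 0≤a₂ 0≤a₁ 0≤c₂ 0≤c₁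
                        (lin-swap _ _ _ _ a≈) (lin-swap _ _ _ _ c≈) ge adc

  open Convexity rk Between

  -- Inside a clean set `Y` of vectors preceding `c`, the members of `C` form a biclosed subset. The
  -- vector `γ c` is not in `Y`, but it lies in the nonnegative spans of this subset and of its
  -- complement in `Y`. Weak separability makes it zero, against reducedness.
  separable : ∀ {C a b a′ b′ c} → BiconvexBelow (rk c) C →
              a ≺ c → b ≺ c → a′ ≺ c → b′ ≺ c →
              C a → C b → ¬ C a′ → ¬ C b′ → Between a c b → Between a′ c b′ → ⊥
  separable {C} {a} {b} {a′} {b′} {c} (convex , coconvex) a≺c b≺c a′≺c b′≺c Ca Cb ¬Ca′ ¬Cb′ acb a′cb′ =
    ℕₚ.<-irrefl (≡.cong rk (≡.sym (on-ray ≤-refl γc≈0))) a≺c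
    where
    -- The rank of `c` is positive since `a` precedes `c`, so a previous position `i` exists;
    -- `initial i` consists of exactly the vectors preceding `c`.
    m : ℕ
    m = ℕ.pred (rk c)
    1+m≡ : rk c ≡ ℕ.suc m
    1+m≡ = ≡.sym (ℕₚ.suc-pred (rk c) {{ℕ.>-nonZero (ℕₚ.≤-<-trans ℕ.z≤n a≺c)}})
    i : Index
    i = proj₁ (predecessor length c 1+m≡)
    1+i≡ : rk c ≡ ℕ.suc (rk i)
    1+i≡ = ≡.trans 1+m≡ (≡.cong ℕ.suc (≡.sym (proj₂ (predecessor length c 1+m≡))))
    ≤i : ∀ {k} → k ≺ c → rk k ℕ.≤ rk i
    ≤i k≺c = ℕₚ.m<1+n⇒m≤n (ℕₚ.≤-trans k≺c (ℕₚ.≤-reflexive 1+i≡))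
    ≺c : ∀ {k} → rk k ℕ.≤ rk i → k ≺ c
    ≺c k≤i = ℕₚ.≤-trans (ℕ.s≤s k≤i) (ℕₚ.≤-reflexive (≡.sym 1+i≡))
    init : ∀ {k} → k ≺ c → γ k ∈ initial i
    init {k} k≺c = k , ≤i k≺c , ≈ᴹ-refl

    clean = locally-clean i (init a≺c) (init b≺c) (init a′≺c)
    F : Subset
    F = proj₁ clean
    full : Full X F
    full = proj₁ (proj₂ clean)
    a∈F : γ a ∈ F
    a∈F = proj₁ (proj₂ (proj₂ clean))
    b∈F : γ b ∈ F
    b∈F = proj₁ (proj₂ (proj₂ (proj₂ clean)))
    a′∈F : γ a′ ∈ F
    a′∈F = proj₁ (proj₂ (proj₂ (proj₂ (proj₂ clean))))
    Y : Subset
    Y = F ∩ initial i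

    F-plane : ∀ {j k l} → γ j ∈ F → γ l ∈ F → Plane (γ j) (γ l) (γ k) → γ k ∈ F
    F-plane {j} {k} {l} j∈F l∈F k∈P = proj₁ (proj₂ (proj₂ full j∈F l∈F)
      (γ∈X k , plane⊆span {S = ⟦ γ j , γ l ⟧} (inj₁ ≈ᴹ-refl) (inj₂ ≈ᴹ-refl) k∈P))

    c∈F : γ c ∈ F
    c∈F = F-plane a∈F b∈F (cone⊆plane acb)
    b′∈F : γ b′ ∈ F
    -- Local cleanness provides for three vectors only. Fullness puts `γ c` in `F` through `a` and
    -- `b`, and then `γ b′`, which lies in the plane of `γ a′` and `γ c`.
    b′∈F = let x , y , 0≤x , 0≤y , c≈ = a′cb′ in F-plane a′∈F c∈F
      (plane-solve (coeffʳ≉0 (λ { ≡.refl → ℕₚ.<-irrefl ≡.refl a′≺c }) 0≤x c≈) c≈)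

    D : Subset
    D v = v ∈ Y × ∃ λ k → C k × γ k ≈ᴹ v
    ∈D : ∀ {k} → k ≺ c → γ k ∈ F → C k → γ k ∈ D
    ∈D {k} k≺c k∈F Ck = (k∈F , init k≺c) , k , Ck , ≈ᴹ-refl
    D⇒C : ∀ {k} → γ k ∈ D → C k
    D⇒C (_ , j , Cj , γj≈) with ≡.refl ← injective γj≈ = Cj

    below : ∀ {k v} → v ∈ Y → γ k ≈ᴹ v → k ≺ c
    below (_ , j , j≤i , γj≈v) γk≈v with ≡.refl ← injective (≈ᴹ-trans γk≈v (≈ᴹ-sym γj≈v)) = ≺c j≤i

    D-biclosed : Biclosed Y D
    D-biclosed = record
      { subset   = proj₁
      ; closed   = λ { (u∈Y , i , Ci , i≈) (v∈Y , j , Cj , j≈) (w∈S , w∈Y@(_ , k , k≤ , k≈)) →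
          w∈Y , k , convex (below u∈Y i≈) (≺c k≤) (below v∈Y j≈) Ci Cj
                      (cone-cong (≈ᴹ-sym i≈) (≈ᴹ-sym j≈) (≈ᴹ-sym k≈) (span₊⇒cone w∈S)) , k≈ }
      ; coclosed = λ { (u∈Y@(_ , i , i≤ , i≈) , u∉D) (v∈Y@(_ , j , j≤ , j≈) , v∉D) (w∈S , w∈Y) →
          w∈Y , λ { (_ , k , Ck , k≈) →
            coconvex (≺c i≤) (below w∈Y k≈) (≺c j≤) (λ Ci → u∉D (u∈Y , i , Ci , i≈)) (λ Cj → v∉D (v∈Y , j , Cj , j≈))
              (cone-cong (≈ᴹ-sym i≈) (≈ᴹ-sym j≈) (≈ᴹ-sym k≈) (span₊⇒cone w∈S)) Ck } }
      }

    γc≈0 : γ c ≈ᴹ 0# *ₗ γ a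
    γc≈0 = ≈ᴹ-trans
      (proj₁ (proj₂ (proj₂ (proj₂ (proj₂ (proj₂ clean)))) D D-biclosed)
        ( cone⊆span₊ {S = D} (∈D a≺c a∈F Ca) (∈D b≺c b∈F Cb) acb
        , cone⊆span₊ {S = Y ∖ D} ((a′∈F , init a′≺c) , ¬Ca′ ∘ D⇒C) ((b′∈F , init b′≺c) , ¬Cb′ ∘ D⇒C) a′cb′))
      (≈ᴹ-sym (*ₗ-zeroˡ (γ a)))

  betweenness : RankedBetweenness ℓ
  betweenness = record
    { Index            = Index
    ; height           = rk
    ; height-injective = rank-injective length
    ; Between          = Between
    ; between-sym      = cone-sym
    ; between-refl     = between-refl
    ; same-side        = same-side
    ; ends             = ends
    ; separable        = separable
    }

-- Classical propositional resizing.

module Resizing (lem : ∀ {a} → ExcludedMiddle a) (ℓ : Level) where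

  -- Once decided by excluded middle, a proposition is replaced by the unit or the empty type, which
  -- can be lifted to any level.
  Resize : ∀ {a} → Set a → Set ℓ
  Resize P = Lift ℓ (True (lem {P = P}))

  resize : ∀ {a} {P : Set a} → P → Resize P
  resize p = lift (fromWitness p)

  unresize : ∀ {a} {P : Set a} → Resize P → P
  unresize (lift p) = toWitness p

-- The gap in a maximal chain left by an inseparable pair.

module MaximalChain
  (lem : ∀ {a} → ExcludedMiddle a)
  {ℓ ι} (ℝ : RealField ℓ) (V : Module (RealField.commutativeRing ℝ) ℓ ℓ) (X : Geometry.Subset ℝ V)
  (reduced : Geometry.Reduced ℝ V X) (fundamental : Geometry.HasFundamentalVectors ℝ V X)
  (O : Geometry.Ordering ℝ V X) (suitable : Geometry.Suitable ℝ V O)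
  {I : Set ι} (B : I → Geometry.Subset ℝ V)
  (maximalChain : Geometry.IsMaximalChain ℝ V X B) where

  open Geometry ℝ V
  open Module V using (_≈ᴹ_; ≈ᴹ-refl; ≈ᴹ-sym; ≈ᴹ-trans)
  open LinearCombinations ℝ V
  open OrderedConfiguration lem ℝ V X reduced fundamental O suitable
  open Ordering O using (Index; γ; injective)
  open Convexity rk Between
  open Interpolation lem betweenness using (Interpolant; interpolate)
  open Resizing lem ℓ
  open IsMaximalChain maximalChain
  open IsChain isChain
  module Bᵢ (i : I) = Biclosed (biclosed i)

  B-resp : ∀ i {u v} → u ≈ᴹ v → u ∈ B i → v ∈ B i
  B-resp i u≈v u∈ = Bᵢ.closed i u∈ u∈
    (cone⇒span₊ (cone-cong ≈ᴹ-refl ≈ᴹ-refl u≈v cone-left) , X-resp u≈v (Bᵢ.subset i u∈))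

  B-convex : ∀ i {a k b} → Between a k b → γ a ∈ B i → γ b ∈ B i → γ k ∈ B i
  B-convex i akb a∈ b∈ = Bᵢ.closed i a∈ b∈ (cone⇒span₊ akb , γ∈X _)

  B-coconvex : ∀ i {a k b} → Between a k b → γ a ∉ B i → γ b ∉ B i → γ k ∉ B i
  B-coconvex i akb a∉ b∉ = proj₂ (Bᵢ.coclosed i (γ∈X _ , a∉) (γ∈X _ , b∉) (cone⇒span₊ akb , γ∈X _))

  module _ {a b : Index} (a≢b : a ≢ b)
           (a∈⇒b∈ : ∀ i → γ a ∈ B i → γ b ∈ B i) (b∈⇒a∈ : ∀ i → γ b ∈ B i → γ a ∈ B i) where

    -- These are a union and an intersection over I : Set ι, whence the resizing to ℓ.
    Below Above : Pred Index ℓ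
    Below k = Resize (∃ λ i → γ a ∉ B i × γ k ∈ B i)
    Above k = Resize (∀ i → γ a ∈ B i → γ k ∈ B i)

    ∉Above : ∀ {k} → ¬ Above k → ∃ λ i → γ a ∈ B i × γ k ∉ B i
    ∉Above k∉ = stable λ none →
      k∉ (resize λ i a∈ → stable λ k∉i → none (i , a∈ , k∉i))

    Below⊆Above : Below ⊆ Above
    Below⊆Above k∈ with unresize k∈
    ... | i , a∉i , k∈i = resize λ j a∈j → go j a∈j (total i j)
      where
      go : ∀ j → γ a ∈ B j → B i ⊆ B j ⊎ B j ⊆ B i → _
      go j a∈j (inj₁ i⊆j) = i⊆j k∈i
      go j a∈j (inj₂ j⊆i) = contradiction (j⊆i a∈j) a∉i

    -- Since the members are nested, two points of the union already lie in a common member. Dually,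
    -- two points outside the intersection `Above` are missed by a common member.
    Below-biconvex : Biconvex Below
    Below-biconvex n = convex , coconvex
      where
      convex : ConvexBelow n Below
      convex _ _ _ x∈ y∈ xky with unresize x∈ | unresize y∈
      ... | i , a∉i , x∈i | j , a∉j , y∈j with total i j
      ...   | inj₁ i⊆j = resize (j , a∉j , B-convex j xky (i⊆j x∈i) y∈j)
      ...   | inj₂ j⊆i = resize (i , a∉i , B-convex i xky x∈i (j⊆i y∈j))
      coconvex : ConvexBelow n (λ k → ¬ Below k)
      coconvex _ _ _ x∉ y∉ xky k∈ with unresize k∈
      ... | i , a∉i , k∈i = B-coconvex i xky (λ x∈i → x∉ (resize (i , a∉i , x∈i)))
                                             (λ y∈i → y∉ (resize (i , a∉i , y∈i))) k∈i

    Above-biconvex : Biconvex Above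
    Above-biconvex n = convex , coconvex
      where
      convex : ConvexBelow n Above
      convex _ _ _ x∈ y∈ xky = resize λ i a∈i → B-convex i xky (unresize x∈ i a∈i) (unresize y∈ i a∈i)
      coconvex : ConvexBelow n (λ k → ¬ Above k)
      coconvex _ _ _ x∉ y∉ xky k∈ with ∉Above x∉ | ∉Above y∉
      ... | i , a∈i , x∉i | j , a∈j , y∉j with total i j
      ...   | inj₁ i⊆j = B-coconvex i xky x∉i (y∉j ∘ i⊆j) (unresize k∈ i a∈i)
      ...   | inj₂ j⊆i = B-coconvex j xky (x∉i ∘ j⊆i) y∉j (unresize k∈ j a∈j)

    module Refine (interpolant : Interpolant Below Above) where
      open Interpolant interpolant

      D : Subset
      D v = ∃ λ k → C k × γ k ≈ᴹ v

      D⇒C : ∀ {k} → γ k ∈ D → C k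
      D⇒C (_ , Cj , γj≈) with ≡.refl ← injective γj≈ = Cj

      D-biclosed : Biclosed X D
      D-biclosed = record
        { subset   = λ (k , _ , k≈) → X-resp k≈ (γ∈X k)
        ; closed   = λ { (i , Ci , i≈) (j , Cj , j≈) (w∈S , w∈X) →
            let k , k≈ = index w∈X
                n , i< , k< , j< = bound i k j
            in k , proj₁ (C-biconvex n) i< k< j< Ci Cj (between i≈ k≈ j≈ w∈S) , k≈ }
        ; coclosed = λ { (u∈X , u∉D) (v∈X , v∉D) (w∈S , w∈X) → w∈X , λ { (k , Ck , k≈) →
            let i , i≈ = index u∈X
                j , j≈ = index v∈X
                n , i< , k< , j< = bound i k j
            in proj₂ (C-biconvex n) i< k< j< (λ Ci → u∉D (i , Ci , i≈)) (λ Cj → v∉D (j , Cj , j≈))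
                 (between i≈ k≈ j≈ w∈S) Ck } }
        }
        where
        bound : ∀ i k j → ∃ λ n → rk i ℕ.< n × rk k ℕ.< n × rk j ℕ.< n
        bound i k j = ℕ.suc (rk i ℕ.+ rk k ℕ.+ rk j) ,
          ℕ.s≤s (ℕₚ.≤-trans (ℕₚ.m≤m+n (rk i) (rk k)) (ℕₚ.m≤m+n _ (rk j))) ,
          ℕ.s≤s (ℕₚ.≤-trans (ℕₚ.m≤n+m (rk k) (rk i)) (ℕₚ.m≤m+n _ (rk j))) ,
          ℕ.s≤s (ℕₚ.m≤n+m (rk j) _)
        between : ∀ {i k j u v w} → γ i ≈ᴹ u → γ k ≈ᴹ w → γ j ≈ᴹ v → w ∈ Span₊ ⟦ u , v ⟧ → Between i k j
        between i≈ k≈ j≈ w∈S = cone-cong (≈ᴹ-sym i≈) (≈ᴹ-sym j≈) (≈ᴹ-sym k≈) (span₊⇒cone w∈S)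

      -- A member containing `γ a` contains `Above`, hence `D`; any other member lies in `Below`,
      -- hence in `D`.
      D-comparable : ∀ i → B i ⊆ D ⊎ D ⊆ B i
      D-comparable i with lem {P = γ a ∈ B i}
      ... | yes a∈i = inj₂ λ (k , Ck , k≈) → B-resp i k≈ (unresize (C⊆B Ck) i a∈i)
      ... | no  a∉i = inj₁ λ v∈i → let k , k≈ = index (Bᵢ.subset i v∈i)
                                   in k , A⊆C (resize (i , a∉i , B-resp i (≈ᴹ-sym k≈) v∈i)) , k≈

      -- The chain with `D` added; `Maybe I` is in the same universe as `I`, as maximality demands.
      refined : Maybe I → Subset
      refined = maybe′ B D

      refined-isChain : IsChain X refined
      refined-isChain = record
        { biclosed = λ { (just i) → biclosed i ; nothing → D-biclosed }
        ; total    = λ { (just i) (just j) → total i j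
                       ; (just i) nothing  → D-comparable i
                       ; nothing  (just j) → swap (D-comparable j)
                       ; nothing  nothing  → inj₁ (λ v∈D → v∈D)
                       }
        }

      -- By maximality `D` equals some `B j`. If `B j` contains `γ a`, it contains all of `Above`,
      -- including `k′`, which is not in `C`. If not, it lies in `Below`, which misses the point `k`
      -- of `C`.
      contradict : ⊥
      contradict with maximal refined refined-isChain (λ i → just i , (λ v∈ → v∈) , (λ v∈ → v∈)) nothing
      ... | j , D⊆Bj , Bj⊆D with lem {P = γ a ∈ B j}
      ...   | yes a∈j = proj₂ k′∈B∖C (D⇒C (Bj⊆D (unresize (proj₁ k′∈B∖C) j a∈j)))
      ...   | no  a∉j = proj₂ k∈C∖A (resize (j , a∉j , D⊆Bj (k , proj₁ k∈C∖A , ≈ᴹ-refl)))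

    not-inseparable : ⊥
    -- The two distinct points of `Above ∖ Below` are `a` and `b` themselves.
    not-inseparable = Refine.contradict (interpolate Below Above Below-biconvex Above-biconvex Below⊆Above a≢b
      (resize (λ _ a∈ → a∈) , λ a∈ → let _ , a∉i , a∈i = unresize a∈ in a∉i a∈i)
      (resize a∈⇒b∈ , λ b∈ → let i , a∉i , b∈i = unresize b∈ in a∉i (b∈⇒a∈ i b∈i)))

  exactly-one : ∀ i {u v} → u ∈ B i → v ∉ B i → ∃! _≈ᴹ_ (⟦ u , v ⟧ ∩ B i)
  exactly-one i {u} u∈ v∉ = u , (inj₁ ≈ᴹ-refl , u∈) ,
    λ { (inj₁ w≈u , _) → ≈ᴹ-sym w≈u ; (inj₂ w≈v , w∈) → contradiction (B-resp i w≈v w∈) v∉ }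

  exactly-one-sym : ∀ i {u v} → ∃! _≈ᴹ_ (⟦ v , u ⟧ ∩ B i) → ∃! _≈ᴹ_ (⟦ u , v ⟧ ∩ B i)
  exactly-one-sym i (w , (w∈ , w∈B) , unique) =
    w , (swap w∈ , w∈B) , λ (x∈ , x∈B) → unique (swap x∈ , x∈B)

  separates : ∀ {u v} → u ∈ X → v ∈ X → ¬ u ≈ᴹ v → ∃ λ i → ∃! _≈ᴹ_ (⟦ u , v ⟧ ∩ B i)
  separates {u} {v} u∈X v∈X u≉v with index u∈X | index v∈X
  ... | a , a≈ | b , b≈ = stable λ inseparable → not-inseparable
    (λ { ≡.refl → u≉v (≈ᴹ-trans (≈ᴹ-sym a≈) b≈) })
    (λ i a∈i → stable λ b∉i → inseparable
      (i , exactly-one i (B-resp i a≈ a∈i) (b∉i ∘ B-resp i (≈ᴹ-sym b≈))))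
    (λ i b∈i → stable λ a∉i → inseparable
      (i , exactly-one-sym i (exactly-one i (B-resp i b≈ b∈i) (a∉i ∘ B-resp i (≈ᴹ-sym a≈)))))

theorem4p3 : (∀ {a} → ExcludedMiddle a) →
    ∀ {ℓ ι} (ℝ : RealField ℓ) (V : Module (RealField.commutativeRing ℝ) ℓ ℓ) →
    let open Geometry ℝ V in
    let open Module V using (_≈ᴹ_) in
    FiniteDimensional →
    ∀ (X : Subset) → Reduced X → HasFundamentalVectors X →
    ∀ (O : Ordering X) → Suitable O →
    ∀ {I : Set ι} (B : I → Subset) → IsMaximalChain X B →
    ∀ {α β} → α ∈ X → β ∈ X → ¬ (α ≈ᴹ β) →
    ∃ λ i → ∃! _≈ᴹ_ (⟦ α , β ⟧ ∩ B i)
theorem4p3 lem ℝ V _ X reduced fundamental O suitable B maximalChain =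
  MaximalChain.separates lem ℝ V X reduced fundamental O suitable B maximalChain
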